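{- Let $A$ and $B$ be 0-1 matrices of sizes $p\times q$ and $q\times r$, respectively, and let $\ell\in[p]$ and $k\in[r]$ be given positive integer parameters. There is a deterministic algorithm which computes a $p\times r$ matrix $D$ approximating every entry of the arithmetic matrix product $C=AB$ within an additive error, namely $|C_{ij}-D_{ij}|$ for all $i\in[p]$, $j\in[r]$, of at most: (1) $2\lambda(A,\ell,\mathrm{row})$, in time $O(pq\ell+pr)$, if $p\ge r$; (2) $2\lambda(B,k,\mathrm{col})$, in time $O(rqk+pr)$, if $p\le r$.
   Context: For a positive integer $r$, $[r]=\{1,\dots,r\}$. The arithmetic matrix product $C=AB$ has entries $C_{ij}=\sum_{h=1}^q A_{ih}B_{hj}$ (computed over the integers). The Hamming distance $\mathrm{ham}(a,b)$ between $a,b\in\{0,1\}^q$ is the number of coordinates in which they differ. For a 0-1 $p\times q$ matrix $A$, $\lambda(A,\ell,\mathrm{row})$ is the minimum, over all sets $T$ of $\ell$ points of $\{0,1\}^q$ (not necessarily rows of $A$), of $\max_{i\in[p]}\min_{u\in T}\mathrm{ham}(A_{i*},u)$, where $A_{i*}$ is the $i$-th row of $A$. For a 0-1 $q\times r$ matrix $B$, $\lambda(B,k,\mathrm{col})$ is the analogous minimum, over all sets of $k$ points of $\{0,1\}^q$, of the maximum Hamming distance from a column of $B$ to its closest point in the set. Running times are in the standard RAM model. -}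

module Defs where

open import Data.Nat.Base using (ℕ; zero; suc; _+_; _*_; _∸_; _^_; _⊓_; _≤_)
open import Data.Nat.Properties using (_≟_)
open import Data.Bool.Base using (if_then_else_)
open import Data.Fin.Base using (Fin; toℕ)
import Data.Fin.Properties as Fin
open import Data.List.Base using (List; []; _∷_; _++_; map; head; drop; allFin; cartesianProductWith)
open import Data.List.Extrema.Nat using (min; max)
open import Data.Maybe.Base using (Maybe; just; nothing)
open import Data.Product.Base using (_×_; _,_)
open import Data.Vec.Base as Vec using (Vec; []; lookup; tabulate; transpose; toList)
open import Relation.Binary.PropositionalEquality.Core using (_≡_)
open import Relation.Nullary.Decidable using (does; ¬?)

private
  variable
    X : Set
    p q r : ℕ

Matrix : Set → ℕ → ℕ → Set
Matrix X m n = Vec (Vec X n) m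

entry : Matrix X p q → Fin p → Fin q → X
entry M i j = lookup (lookup M i) j

Matrix01 : ℕ → ℕ → Set
Matrix01 = Matrix (Fin 2)

infixl 7 _⊗_

_⊗_ : Matrix01 p q → Matrix01 q r → Matrix ℕ p r
A ⊗ B = tabulate λ i → tabulate λ j →
  Vec.sum (tabulate λ h → toℕ (entry A i h) * toℕ (entry B h j))

Point : ℕ → Set
Point q = Vec (Fin 2) q

ham : Point q → Point q → ℕ
ham a b = Vec.count (λ (x , y) → ¬? (x Fin.≟ y)) (Vec.zip a b)

points : ∀ q → List (Point q)
points zero    = [] ∷ []
points (suc q) = cartesianProductWith Vec._∷_ (allFin 2) (points q)

-- All sublists with exactly n elements; for a duplicate-free list these are
-- the n-element subsets, each listed once.
choose : ℕ → List X → List (List X)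
choose zero    xs       = [] ∷ []
choose (suc n) []       = []
choose (suc n) (x ∷ xs) = map (x ∷_) (choose n xs) ++ choose (suc n) xs

-- The first argument of min and max is an extra element of the collection.
-- No Hamming distance in {0,1}^q exceeds q, so starting a minimum over a
-- non-empty collection of distances at q does not change its value.
distance : Point q → List (Point q) → ℕ
distance {q} a T = min q (map (ham a) T)

radius : List (Point q) → List (Point q) → ℕ
radius as T = max 0 (map (λ a → distance a T) as)

-- {0,1}^q has 2 ^ q points.  If ℓ is larger there is no set of ℓ points, and
-- the whole cube is used instead, giving the value 0 as for ℓ = 2 ^ q.
λ-row : Matrix01 p q → ℕ → ℕ
λ-row {q = q} A ℓ = min q (map (radius (toList A)) (choose (ℓ ⊓ 2 ^ q) (points q)))

λ-col : Matrix01 q r → ℕ → ℕ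
λ-col B k = λ-row (transpose B) k

-- A random access machine in the style of Cook and Reckhow, with the
-- registers named by a program kept apart from the indirectly addressed
-- memory.  All words are natural numbers, sub is truncated, and there is no
-- multiplication.  A jump target is a position in the program, and the machine
-- halts when the program counter leaves the program.
Reg : Set
Reg = ℕ

data Instr : Set where
  const : (d : Reg) (n : ℕ) → Instr
  addi  : (d a : Reg) (n : ℕ) → Instr
  add   : (d a b : Reg) → Instr
  sub   : (d a b : Reg) → Instr
  load  : (d a : Reg) → Instr
  store : (a s : Reg) → Instr
  jmp   : (target : ℕ) → Instr
  jz    : (a : Reg) (target : ℕ) → Instr

Program : Set
Program = List Instr

record State : Set where
  constructor ⟨_,_,_⟩
  field
    pc  : ℕ
    reg : Reg → ℕ
    mem : ℕ → ℕ

open State public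

fetch : Program → ℕ → Maybe Instr
fetch P n = head (drop n P)

_[_≔_] : (ℕ → ℕ) → ℕ → ℕ → (ℕ → ℕ)
(f [ x ≔ v ]) y = if does (y ≟ x) then v else f y

exec : Instr → State → State
exec (const d n) ⟨ pc , R , M ⟩ = ⟨ suc pc , R [ d ≔ n ] , M ⟩
exec (addi d a n) ⟨ pc , R , M ⟩ = ⟨ suc pc , R [ d ≔ R a + n ] , M ⟩
exec (add d a b) ⟨ pc , R , M ⟩ = ⟨ suc pc , R [ d ≔ R a + R b ] , M ⟩
exec (sub d a b) ⟨ pc , R , M ⟩ = ⟨ suc pc , R [ d ≔ R a ∸ R b ] , M ⟩
exec (load d a)  ⟨ pc , R , M ⟩ = ⟨ suc pc , R [ d ≔ M (R a) ] , M ⟩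
exec (store a s) ⟨ pc , R , M ⟩ = ⟨ suc pc , R , M [ R a ≔ R s ] ⟩
exec (jmp t)     ⟨ pc , R , M ⟩ = ⟨ t , R , M ⟩
exec (jz a t)    ⟨ pc , R , M ⟩ = ⟨ (if does (R a ≟ 0) then t else suc pc) , R , M ⟩

Halted : Program → State → Set
Halted P s = fetch P (pc s) ≡ nothing

step : Program → State → State
step P s with fetch P (pc s)
... | just i  = exec i s
... | nothing = s

run : Program → ℕ → State → State
run P zero    s = s
run P (suc n) s = run P n (step P s)

-- The given words from address 0 on, followed by zeros.
cells : List ℕ → ℕ → ℕ
cells []       _       = 0
cells (x ∷ xs) zero    = x
cells (x ∷ xs) (suc a) = cells xs a

rowMajor : Matrix01 p q → List ℕ
rowMajor A = map toℕ (toList (Vec.concat A))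

-- The sizes and parameters are in registers 0 to 4; the memory holds A
-- followed by B.
input : Matrix01 p q → Matrix01 q r → (ℓ k : ℕ) → State
input {p} {q} {r} A B ℓ k =
  ⟨ 0 , cells (p ∷ q ∷ r ∷ ℓ ∷ k ∷ []) , cells (rowMajor A ++ rowMajor B) ⟩

-- The result is stored row by row, from the address found in register 0.
Output : State → Matrix ℕ p r → Set
Output {p} {r} s D =
  (i : Fin p) (j : Fin r) → mem s (reg s 0 + (toℕ i * r + toℕ j)) ≡ entry D i j

WordsBounded : ℕ → State → Set
WordsBounded b s = (∀ x → reg s x ≤ b) × (∀ x → mem s x ≤ b)

-- Every instruction costs one unit of time.  So that unit cost cannot be
-- exploited by computing with huge numbers, the same bound is imposed on the
-- values of all words (in particular on all addresses) at all times: for a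
-- polynomial bound, words have logarithmically many bits.
record Computes (P : Program) (s : State) (D : Matrix ℕ p r) (bound : ℕ) : Set where
  field
    time       : ℕ
    time-bound : time ≤ bound
    word-bound : ∀ n → n ≤ time → WordsBounded bound (run P n s)
    halts      : Halted P (run P time s)
    output     : Output (run P time s) D

{-# OPTIONS --safe #-}
module Submission where

-- The rows of A are clustered by Gonzalez's farthest-first traversal: each of ℓ
-- rounds makes the row farthest from the previous centres a new centre and
-- multiplies it with B.  If a row is at distance δ from its closest centre, then
-- this row and the ℓ centres are ℓ + 1 points at mutual distances at least δ, two
-- of which share a closest point in any set of ℓ points, so δ ≤ 2 λ.  The entries
-- of C in two rows of A at distance δ differ by at most δ.  The second case is the
-- first one for the transposed matrices, which are addressed in place.

open import Defs
open import Algebra.Properties.CommutativeSemigroup using (x∙yz≈y∙xz)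
open import Data.Bool.Base using (Bool; true; false; not; _∨_; T)
open import Data.Bool.ListAction using (all; any)
open import Data.Empty using (⊥)
open import Data.Fin.Base as Fin using (Fin; zero; suc; toℕ; fromℕ<)
import Data.Fin.Properties as Fin
open import Data.List.Base as List using (List; []; _∷_; _++_; length; drop)
open import Data.List.Extrema.Nat using (argmin-sel; xs≤max)
open import Data.List.Membership.Propositional using (_∈_)
open import Data.List.Membership.Propositional.Properties using (∈-map⁻; ∈-++⁻) renaming (∈-lookup to ∈ₗ-lookup)
open import Data.List.Properties using (++-assoc; ++-identityʳ; drop-all; drop-drop; length-++; length-map)
open import Data.List.Relation.Unary.All as All using (All; []; _∷_)
import Data.List.Relation.Unary.All.Properties as All
open import Data.List.Relation.Unary.AllPairs as AllPairs using (AllPairs; []; _∷_)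
open import Data.List.Relation.Unary.Any as Any using (Any; here; there)
open import Data.List.Relation.Unary.Any.Properties using (lookup-index)
open import Data.Maybe.Base using (just)
open import Data.Nat.Base
open import Data.Nat.Properties
open import Data.Product.Base using (_×_; _,_; proj₁; proj₂; ∃-syntax; swap)
open import Data.Sum.Base using (_⊎_; inj₁; inj₂; map₁; map₂)
open import Data.Unit.Base using (⊤; tt)
open import Data.Vec.Base as Vec using (Vec; []; _∷_; lookup; tabulate; toList; transpose; concat)
open import Data.Vec.Membership.Propositional.Properties using (∈-lookup; ∈-toList⁺)
open import Data.Vec.Properties using (lookup-⊛; lookup-replicate; lookup-concat; lookup∘tabulate; length-toList)
open import Function.Base using (_∘_; _$_; id)
open import Relation.Binary.Definitions using (tri<; tri≈; tri>)
open import Relation.Binary.PropositionalEquality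
open import Relation.Nullary.Decidable using (yes; no)
open import Relation.Nullary.Negation using (contradiction)

-- Structured programs and their compilation

-- Each row keeps its closeness to the nearest centre so far and a pointer to the products of that
-- centre. A round then compares all rows with one new centre only and costs on the order of
-- `p * q + r * q` steps, where `r ≤ p` absorbs the second term; the result itself is written once,
-- after the rounds. The machine shapes the rest. It has no multiplication, so addresses advance by
-- strides and `p * q` is found by repeated addition. Jumps are hidden behind structured commands
-- with a verified compiler. Every word must obey the same bound as the time: with `Z` the
-- expression inside the time bound, words start below `8 * Z` and grow by at most one per step
-- unless two registers are added, so only those additions need a proof. At most `121 * Z` steps
-- then give the constant 129.

T⇒≡true : ∀ {b} → T b → b ≡ true
T⇒≡true {true} _ = refl

≔-same : ∀ f {x y v} → y ≡ x → (f [ x ≔ v ]) y ≡ v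
≔-same f {x} {y} eq with y ≡ᵇ x in e
... | true  = refl
... | false = contradiction (trans (sym e) (T⇒≡true (≡⇒≡ᵇ y x eq))) λ ()

≔-other : ∀ f {x y v} → y ≢ x → (f [ x ≔ v ]) y ≡ f y
≔-other f {x} {y} y≢x with y ≡ᵇ x in e
... | true  = contradiction (≡ᵇ⇒≡ y x (subst T (sym e) tt)) y≢x
... | false = refl

Store : Set
Store = (Reg → ℕ) × (ℕ → ℕ)

act : Instr → Store → Store
act i (R , M) = let s = exec i ⟨ 0 , R , M ⟩ in reg s , mem s

acts : List Instr → Store → Store
acts []       σ = σ
acts (i ∷ is) σ = acts is (act i σ)

-- A word grows by at most one per step, except in an addition of two
-- registers, whose result has to be bounded separately.
Safe : ℕ → Instr → Store → Set
Safe b (const d n)  σ       = T (n ≤ᵇ 1)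
Safe b (addi d a n) σ       = T (n ≤ᵇ 1)
Safe b (add d a c)  (R , M) = R a + R c ≤ b
Safe b (sub d a c)  σ       = ⊤
Safe b (load d a)   σ       = ⊤
Safe b (store a s)  σ       = ⊤
Safe b (jmp t)      σ       = ⊥
Safe b (jz a t)     σ       = ⊥

AllSafe : ℕ → List Instr → Store → Set
AllSafe b []       σ = ⊤
AllSafe b (i ∷ is) σ = Safe b i σ × AllSafe b is (act i σ)

-- No instruction subtracts a constant, so loop counters are lowered by this register, the first one
-- after the input registers. `measure` sets it to 1.
one : Reg
one = 5

infixr 5 _⨾_

data Cmd : Set where
  ops : List Instr → Cmd
  _⨾_ : Cmd → Cmd → Cmd
  if  : Reg → Cmd → Cmd
  for : Reg → Cmd → Cmd

size : Cmd → ℕ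
size (ops is)  = length is
size (c ⨾ d)   = size c + size d
size (if x c)  = suc (size c)
size (for x c) = suc (size c + 2)

-- Jump targets are absolute, so code is generated for the position `o` at which it will stand.
compile : ℕ → Cmd → Program
compile o (ops is)  = is
compile o (c ⨾ d)   = compile o c ++ compile (o + size c) d
compile o (if x c)  = jz x (o + suc (size c)) ∷ compile (suc o) c
compile o (for x c) =
  jz x (o + suc (size c + 2)) ∷ compile (suc o) c ++ sub x x one ∷ jmp o ∷ []

length-compile : ∀ o c → length (compile o c) ≡ size c
length-compile o (ops is)  = refl
length-compile o (c ⨾ d)   =
  trans (length-++ (compile o c)) (cong₂ _+_ (length-compile o c) (length-compile _ d))
length-compile o (if x c)  = cong suc (length-compile _ c)
length-compile o (for x c) =
  cong suc (trans (length-++ (compile (suc o) c)) (cong (_+ 2) (length-compile _ c)))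

data _⊢_⟨_⟩⇓[_]_ (b : ℕ) : Cmd → Store → ℕ → Store → Set where
  done  : ∀ {σ} → b ⊢ ops [] ⟨ σ ⟩⇓[ 0 ] σ
  op    : ∀ {i is σ n τ} → Safe b i σ → b ⊢ ops is ⟨ act i σ ⟩⇓[ n ] τ →
          b ⊢ ops (i ∷ is) ⟨ σ ⟩⇓[ suc n ] τ
  seq   : ∀ {c d σ τ υ m n} → b ⊢ c ⟨ σ ⟩⇓[ m ] τ → b ⊢ d ⟨ τ ⟩⇓[ n ] υ →
          b ⊢ c ⨾ d ⟨ σ ⟩⇓[ m + n ] υ
  skip  : ∀ {x c σ} → proj₁ σ x ≡ 0 → b ⊢ if x c ⟨ σ ⟩⇓[ 1 ] σ
  enter : ∀ {x c σ τ n} → proj₁ σ x ≢ 0 → b ⊢ c ⟨ σ ⟩⇓[ n ] τ →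
          b ⊢ if x c ⟨ σ ⟩⇓[ suc n ] τ
  exit  : ∀ {x c σ} → proj₁ σ x ≡ 0 → b ⊢ for x c ⟨ σ ⟩⇓[ 1 ] σ
  again : ∀ {x c σ τ υ m n} → proj₁ σ x ≢ 0 → b ⊢ c ⟨ σ ⟩⇓[ m ] τ →
          b ⊢ for x c ⟨ act (sub x x one) τ ⟩⇓[ n ] υ →
          b ⊢ for x c ⟨ σ ⟩⇓[ 1 + (m + (2 + n)) ] υ

_at_ : ℕ → Store → State
o at (R , M) = ⟨ o , R , M ⟩

-- Growth is claimed for every `w` above `b`, so that runs compose: the second one starts from the
-- larger bound that the first one has reached.
record Runs (P : Program) (b : ℕ) (s : State) (n : ℕ) (t : State) : Set where
  field
    final : run P n s ≡ t
    grows : ∀ w → b ≤ w → WordsBounded w s → ∀ m → m ≤ n → WordsBounded (w + m) (run P m s)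

open Runs

run-+ : ∀ P m n s → run P (m + n) s ≡ run P n (run P m s)
run-+ P zero    n s = refl
run-+ P (suc m) n s = run-+ P m n (step P s)

runs-++ : ∀ {P b s t u m n} → Runs P b s m t → Runs P b t n u → Runs P b s (m + n) u
runs-++ {P} {s = s} {m = m} {n} f g .final =
  trans (run-+ P m n s) (trans (cong (run P n) (f .final)) (g .final))
runs-++ {P} {s = s} {t} {m = m} {n} f g .grows w b≤w ws k k≤m+n with ≤-total k m
... | inj₁ k≤m = f .grows w b≤w ws k k≤m
... | inj₂ m≤k = subst₂ WordsBounded (trans (+-assoc w m (k ∸ m)) (cong (w +_) (m+[n∸m]≡n m≤k)))
    (trans (cong (run P (k ∸ m)) (sym (f .final)))
      (trans (sym (run-+ P m (k ∸ m) s)) (cong (λ z → run P z s) (m+[n∸m]≡n m≤k))))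
    (g .grows (w + m) (≤-trans b≤w (m≤m+n w m))
      (subst (WordsBounded (w + m)) (f .final) (f .grows w b≤w ws m ≤-refl))
      (k ∸ m) (≤-trans (∸-monoˡ-≤ m k≤m+n) (≤-reflexive (m+n∸m≡n m n))))

runs-0 : ∀ {P b s} → Runs P b s 0 s
runs-0 .final = refl
runs-0 {s = s} .grows w _ ws .0 z≤n = subst (λ v → WordsBounded v s) (sym (+-identityʳ w)) ws

step-fetch : ∀ P s {i} → fetch P (pc s) ≡ just i → step P s ≡ exec i s
step-fetch P s eq with fetch P (pc s)
step-fetch P s refl | just i = refl

widen : ∀ {v w} s → v ≤ w → WordsBounded v s → WordsBounded w s
widen s v≤w (rs , ms) = (λ x → ≤-trans (rs x) v≤w) , (λ x → ≤-trans (ms x) v≤w)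

runs-1 : ∀ {P b s i} → fetch P (pc s) ≡ just i →
         (∀ w → b ≤ w → WordsBounded w s → WordsBounded (w + 1) (exec i s)) →
         Runs P b s 1 (exec i s)
runs-1 {P} {s = s} eq h .final = step-fetch P s eq
runs-1 {s = s} eq h .grows w b≤w ws zero _ = runs-0 {[]} {0} {s} .grows w z≤n ws 0 z≤n
runs-1 {P} {s = s} eq h .grows w b≤w ws (suc zero) _ =
  subst (WordsBounded (w + 1)) (sym (step-fetch P s eq)) (h w b≤w ws)
runs-1 eq h .grows w b≤w ws (suc (suc m)) (s≤s ())

≔-bounded : ∀ {f w x v} → (∀ y → f y ≤ w) → v ≤ w → ∀ y → (f [ x ≔ v ]) y ≤ w
≔-bounded {x = x} fs v≤w y with y ≡ᵇ x
... | true  = v≤w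
... | false = fs y

exec-grows : ∀ {b w o} i σ → Safe b i σ → b ≤ w → WordsBounded w (o at σ) →
             WordsBounded (w + 1) (exec i (o at σ))
exec-grows {w = w} (const d n) (R , M) ok b≤w ws =
  let rs , ms = widen ⟨ 0 , R , M ⟩ (m≤m+n w 1) ws
  in ≔-bounded rs (≤-trans (≤ᵇ⇒≤ n 1 ok) (m≤n+m 1 w)) , ms
exec-grows {w = w} (addi d a n) (R , M) ok b≤w ws =
  let rs , ms = widen ⟨ 0 , R , M ⟩ (m≤m+n w 1) ws
  in ≔-bounded rs (+-mono-≤ (proj₁ ws a) (≤ᵇ⇒≤ n 1 ok)) , ms
exec-grows {w = w} (add d a c) (R , M) ok b≤w ws =
  let rs , ms = widen ⟨ 0 , R , M ⟩ (m≤m+n w 1) ws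
  in ≔-bounded rs (≤-trans ok (≤-trans b≤w (m≤m+n w 1))) , ms
exec-grows {w = w} (sub d a c) (R , M) ok b≤w ws =
  let rs , ms = widen ⟨ 0 , R , M ⟩ (m≤m+n w 1) ws
  in ≔-bounded rs (≤-trans (m∸n≤m (R a) (R c)) (rs a)) , ms
exec-grows {w = w} (load d a) (R , M) ok b≤w ws =
  let rs , ms = widen ⟨ 0 , R , M ⟩ (m≤m+n w 1) ws
  in ≔-bounded rs (ms (R a)) , ms
exec-grows {w = w} (store a s) (R , M) ok b≤w ws =
  let rs , ms = widen ⟨ 0 , R , M ⟩ (m≤m+n w 1) ws
  in rs , ≔-bounded ms (rs s)

exec-at : ∀ {b o} i σ → Safe b i σ → exec i (o at σ) ≡ suc o at act i σ
exec-at (const d n)  σ ok = refl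
exec-at (addi d a n) σ ok = refl
exec-at (add d a c)  σ ok = refl
exec-at (sub d a c)  σ ok = refl
exec-at (load d a)   σ ok = refl
exec-at (store a s)  σ ok = refl

runs-op : ∀ {P b o i σ} → fetch P o ≡ just i → Safe b i σ → Runs P b (o at σ) 1 (suc o at act i σ)
runs-op {P} {b} {o} {i} {σ} eq ok =
  subst (Runs P b (o at σ) 1) (exec-at i σ ok) (runs-1 eq λ w → exec-grows {b = b} i σ ok)

runs-jump : ∀ {P b o t} i {σ} → fetch P o ≡ just i → exec i (o at σ) ≡ t at σ →
            Runs P b (o at σ) 1 (t at σ)
runs-jump {P} {b} {o} {t} i {σ} eq jump = subst (Runs P b (o at σ) 1) jump
  (runs-1 eq λ w _ ws → subst (WordsBounded (w + 1)) (sym jump) (widen (o at σ) (m≤m+n w 1) ws))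

jz-taken : ∀ {o t x} σ → proj₁ σ x ≡ 0 → exec (jz x t) (o at σ) ≡ t at σ
jz-taken (R , M) eq rewrite eq = refl

jz-not-taken : ∀ {o t x} σ → proj₁ σ x ≢ 0 → exec (jz x t) (o at σ) ≡ suc o at σ
jz-not-taken {x = x} (R , M) ne with R x
... | zero  = contradiction refl ne
... | suc _ = refl

-- Recording only the suffix at `o` keeps the code before it out of the induction.
record Placed (P : Program) (o : ℕ) (is : Program) : Set where
  constructor placed
  field
    {rest}  : Program
    drop-eq : drop o P ≡ is ++ rest

retarget : ∀ {P b s n o o′ τ} → o ≡ o′ → Runs P b s n (o at τ) → Runs P b s n (o′ at τ)
retarget refl f = f

placed-fetch : ∀ {P o i is} → Placed P o (i ∷ is) → fetch P o ≡ just i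
placed-fetch (placed eq) = cong List.head eq

placed-++ˡ : ∀ {P o} is {js} → Placed P o (is ++ js) → Placed P o is
placed-++ˡ is (placed {rest} eq) = placed $ trans eq (++-assoc is _ rest)

placed-++ʳ : ∀ {P o} is {js n} → length is ≡ n → Placed P o (is ++ js) → Placed P (o + n) js
placed-++ʳ {P} {o} is {js} refl (placed {rest} eq) = placed (begin
  drop (o + length is) P               ≡⟨ drop-drop o (length is) P ⟨
  drop (length is) (drop o P)          ≡⟨ cong (drop (length is)) (trans eq (++-assoc is js rest)) ⟩
  drop (length is) (is ++ js ++ rest)  ≡⟨ drop-length is ⟩
  js ++ rest                           ∎)
  where
  open ≡-Reasoning
  drop-length : ∀ (xs : Program) {ys} → drop (length xs) (xs ++ ys) ≡ ys
  drop-length []       = refl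
  drop-length (_ ∷ xs) = drop-length xs

placed-tail : ∀ {P o i is} → Placed P o (i ∷ is) → Placed P (suc o) is
placed-tail {P} {o} {i} {is} pl = subst (λ z → Placed P z is) (+-comm o 1) (placed-++ʳ (i ∷ []) refl pl)

-- The recursion is on the evaluation, not on the command, because a loop reappears as its own
-- continuation.
compile-correct : ∀ {P b c σ n τ} o → b ⊢ c ⟨ σ ⟩⇓[ n ] τ → Placed P o (compile o c) →
                  Runs P b (o at σ) n ((o + size c) at τ)
compile-correct {P} {b} {σ = σ} o done pl =
  retarget (sym (+-identityʳ o)) runs-0
compile-correct {P} {b} {ops (i ∷ is)} {σ} {suc n} {τ} o (op ok e) pl =
  retarget (sym (+-suc o (length is)))
    (runs-++ (runs-op (placed-fetch pl) ok) (compile-correct (suc o) e (placed-tail pl)))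
compile-correct {P} {b} {c ⨾ d} {σ} {_} {τ} o (seq e f) pl =
  retarget (+-assoc o (size c) (size d))
    (runs-++ (compile-correct o e (placed-++ˡ (compile o c) pl))
      (compile-correct (o + size c) f (placed-++ʳ (compile o c) (length-compile o c) pl)))
compile-correct {σ = σ} o (skip eq) pl = runs-jump (jz _ _) (placed-fetch pl) (jz-taken σ eq)
compile-correct {P} {b} {if x c} {σ} {_} {τ} o (enter ne e) pl =
  retarget (sym (+-suc o (size c)))
    (runs-++ (runs-jump (jz _ _) (placed-fetch pl) (jz-not-taken σ ne))
      (compile-correct (suc o) e (placed-tail pl)))
compile-correct {σ = σ} o (exit eq) pl = runs-jump (jz _ _) (placed-fetch pl) (jz-taken σ eq)
compile-correct {P} {b} {for x c} {σ} {_} {τ} o (again ne e f) pl =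
  runs-++ (runs-jump (jz _ _) (placed-fetch pl) (jz-not-taken σ ne))
    (runs-++ (compile-correct (suc o) e (placed-++ˡ (compile (suc o) c) (placed-tail pl)))
      (runs-++ (runs-op (placed-fetch end) tt)
        (runs-++ (runs-jump (jmp o) (placed-fetch (placed-tail end)) refl)
          -- The jump leads back to `o`, so the remaining passes use the placement of the whole loop
          -- again.
          (compile-correct o f pl))))
  where
  end : Placed P (suc o + size c) (sub x x one ∷ jmp o ∷ [])
  end = placed-++ʳ (compile (suc o) c) (length-compile (suc o) c) (placed-tail pl)

-- Registers that a command leaves alone

target : Instr → Reg → Bool
target (const d _)  x = x ≡ᵇ d
target (addi d _ _) x = x ≡ᵇ d
target (add d _ _)  x = x ≡ᵇ d
target (sub d _ _)  x = x ≡ᵇ d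
target (load d _)   x = x ≡ᵇ d
target (store _ _)  x = false
target (jmp _)      x = false
target (jz _ _)     x = false

writes : Cmd → Reg → Bool
writes (ops [])       x = false
writes (ops (i ∷ is)) x = target i x ∨ writes (ops is) x
writes (c ⨾ d)        x = writes c x ∨ writes d x
writes (if _ c)       x = writes c x
writes (for y c)      x = (x ≡ᵇ y) ∨ writes c x

-- A Boolean test, so that for concrete commands and registers `tt` is a proof.
Keeps : Cmd → Reg → Set
Keeps c x = T (not (writes c x))

Same : Cmd → Store → Store → Set
Same c σ τ = ∀ x → Keeps c x → proj₁ τ x ≡ proj₁ σ x

not-∨ˡ : ∀ a {b} → T (not (a ∨ b)) → T (not a)
not-∨ˡ false _ = tt

not-∨ʳ : ∀ a {b} → T (not (a ∨ b)) → T (not b)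
not-∨ʳ false t = t

≔-keeps : ∀ f {x d v} → T (not (x ≡ᵇ d)) → (f [ d ≔ v ]) x ≡ f x
≔-keeps f {x} {d} t with x ≡ᵇ d
... | false = refl

act-keeps : ∀ {b} i σ x → Safe b i σ → T (not (target i x)) → proj₁ (act i σ) x ≡ proj₁ σ x
act-keeps (const d n)  (R , M) x ok t = ≔-keeps R t
act-keeps (addi d a n) (R , M) x ok t = ≔-keeps R t
act-keeps (add d a c)  (R , M) x ok t = ≔-keeps R t
act-keeps (sub d a c)  (R , M) x ok t = ≔-keeps R t
act-keeps (load d a)   (R , M) x ok t = ≔-keeps R t
act-keeps (store a s)  (R , M) x ok t = refl

eval-keeps : ∀ {b c σ n τ} → b ⊢ c ⟨ σ ⟩⇓[ n ] τ → Same c σ τ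
eval-keeps done x t = refl
eval-keeps {σ = σ} (op {i = i} ok e) x t =
  trans (eval-keeps e x (not-∨ʳ (target i x) t)) (act-keeps i σ x ok (not-∨ˡ (target i x) t))
eval-keeps {c = c ⨾ d} (seq e f) x t =
  trans (eval-keeps f x (not-∨ʳ (writes c x) t)) (eval-keeps e x (not-∨ˡ (writes c x) t))
eval-keeps (skip _)    x t = refl
eval-keeps (enter _ e) x t = eval-keeps e x t
eval-keeps (exit _)    x t = refl
eval-keeps {c = for y c} (again {τ = τ} _ e f) x t =
  trans (eval-keeps f x t) (trans (≔-keeps (proj₁ τ) (not-∨ˡ (x ≡ᵇ y) t))
    (eval-keeps e x (not-∨ʳ (x ≡ᵇ y) t)))

-- Total correctness with time bounds

record Ends (b : ℕ) (c : Cmd) (σ : Store) (n : ℕ) (Q : Store → Set) : Set where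
  constructor ends
  field
    {steps} : ℕ
    {end}   : Store
    eval    : b ⊢ c ⟨ σ ⟩⇓[ steps ] end
    steps≤  : steps ≤ n
    post    : Q end

-- Consequence rule. Unchanged registers come for free from `eval-keeps`, so postconditions only
-- have to speak of what a command changes.
ends-weaken : ∀ {b c σ m n P Q} → m ≤ n → (∀ τ → Same c σ τ → P τ → Q τ) →
              Ends b c σ m P → Ends b c σ n Q
ends-weaken m≤n h (ends e le p) = ends e (≤-trans le m≤n) (h _ (eval-keeps e) p)

ends-ops : ∀ {b} is {σ Q} → AllSafe b is σ → Q (acts is σ) → Ends b (ops is) σ (length is) Q
ends-ops []       ok        q = ends done z≤n q
ends-ops (i ∷ is) (ok , oks) q with ends e le q′ ← ends-ops is oks q = ends (op ok e) (s≤s le) q′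

ends-seq : ∀ {b c d σ m n P Q} → Ends b c σ m P →
           (∀ τ → Same c σ τ → P τ → Ends b d τ n Q) → Ends b (c ⨾ d) σ (m + n) Q
ends-seq (ends e le p) h with ends f le′ q ← h _ (eval-keeps e) p = ends (seq e f) (+-mono-≤ le le′) q

ends-ops⨾ : ∀ {b} is {c σ n Q} → AllSafe b is σ → Ends b c (acts is σ) n Q →
            Ends b (ops is ⨾ c) σ (length is + n) Q
ends-ops⨾ is ok e = ends-seq {P = _≡ acts is _} (ends-ops is ok refl) λ { _ _ refl → e }

acts-same : ∀ {b} is {σ} → AllSafe b is σ → Same (ops is) σ (acts is σ)
acts-same is {σ} ok with ends e _ refl ← ends-ops is {Q = _≡ acts is σ} ok refl = eval-keeps e

ends-if : ∀ {b x c σ n Q} → (proj₁ σ x ≡ 0 → Q σ) → (proj₁ σ x ≢ 0 → Ends b c σ n Q) →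
          Ends b (if x c) σ (suc n) Q
ends-if {x = x} {σ = σ} h₀ h₁ with proj₁ σ x ≟ 0
... | yes eq = ends (skip eq) (s≤s z≤n) (h₀ eq)
... | no ne with ends e le q ← h₁ ne = ends (enter ne e) (s≤s le) q

-- The 3 is the test, the decrement and the jump back of each pass, the `suc` the test that leaves
-- the loop.
forCost : ℕ → ℕ → ℕ
forCost n t = suc (n * (3 + t))

-- The body writes neither the counter nor `one`, so each pass lowers the counter by exactly one.
-- The invariant is indexed by completed passes and has to hold again only after the decrement.
ends-for : ∀ {b x c n t σ} (I : ℕ → Store → Set) → x ≢ one → Keeps c x → Keeps c one →
           proj₁ σ x ≡ n → proj₁ σ one ≡ 1 → I 0 σ →
           (∀ k τ → k < n → Same (for x c) σ τ → I k τ →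
             Ends b c τ t (λ υ → I (suc k) (act (sub x x one) υ))) →
           Ends b (for x c) σ (forCost n t) (I n)
ends-for {b} {x} {c} {n} {t} {σ} I x≢one keep-x keep-one x≡n one≡1 base next =
  go n σ (+-identityʳ n) x≡n one≡1 (λ _ _ → refl) base
  where
  go : ∀ m {k} τ → m + k ≡ n → proj₁ τ x ≡ m → proj₁ τ one ≡ 1 → Same (for x c) σ τ → I k τ →
       Ends b (for x c) τ (forCost m t) (I n)
  go zero    τ refl x≡0 one≡1 same inv = ends (exit x≡0) ≤-refl inv
  go (suc m) {k} τ eq x≡m one≡1 same inv
    with ends {end = υ} e le inv′ ← next k τ (≤-trans (s≤s (m≤n+m k m)) (≤-reflexive eq)) same inv
    with ends f le′ q ← go m (act (sub x x one) υ) (trans (+-suc m k) eq)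
           (trans (≔-same (proj₁ υ) refl)
             (cong₂ _∸_ (trans (eval-keeps e x keep-x) x≡m) (trans (eval-keeps e one keep-one) one≡1)))
           (trans (≔-other (proj₁ υ) (x≢one ∘ sym)) (trans (eval-keeps e one keep-one) one≡1))
           (λ y t → trans (≔-keeps (proj₁ υ) (not-∨ˡ (y ≡ᵇ x) t))
             (trans (eval-keeps e y (not-∨ʳ (y ≡ᵇ x) t)) (same y t)))
           inv′
    = ends (again (λ x≡0 → 0≢1+n (trans (sym x≡0) x≡m)) e f) bound q
    where
    open ≤-Reasoning
    bound : _ ≤ forCost (suc m) t
    bound = s≤s (begin
      _ + (2 + _)             ≤⟨ +-mono-≤ le (s≤s (s≤s le′)) ⟩
      t + (3 + m * (3 + t))   ≡⟨ +-assoc t 3 _ ⟨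
      (t + 3) + m * (3 + t)   ≡⟨ cong (_+ m * (3 + t)) (+-comm t 3) ⟩
      suc m * (3 + t)         ∎)

-- The program and its execution

∑ : ℕ → (ℕ → ℕ) → ℕ
∑ zero    f = 0
∑ (suc n) f = ∑ n f + f n

∑-cong : ∀ n {f g} → (∀ h → h < n → f h ≡ g h) → ∑ n f ≡ ∑ n g
∑-cong zero    eq = refl
∑-cong (suc n) eq = cong₂ _+_ (∑-cong n λ h h<n → eq h (m<n⇒m<1+n h<n)) (eq n ≤-refl)

∑-≤ : ∀ n {f} → (∀ h → h < n → f h ≤ 1) → ∑ n f ≤ n
∑-≤ zero    le = z≤n
∑-≤ (suc n) le =
  ≤-trans (+-mono-≤ (∑-≤ n λ h h<n → le h (m<n⇒m<1+n h<n)) (le n ≤-refl)) (≤-reflexive (+-comm n 1))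

stride : ∀ {v x s t} k → v ≡ x + k * s → t ≡ s → v + t ≡ x + suc k * s
stride {x = x} {s} k refl refl = trans (+-assoc x (k * s) s) (cong (x +_) (+-comm (k * s) s))

next : ∀ {v x k} → v ≡ x + k → v + 1 ≡ x + suc k
next {x = x} {k} refl = trans (+-comm (x + k) 1) (sym (+-suc x k))

-- For `addi d a 0`, the way to copy a register.
copied : ∀ {v x : ℕ} → v ≡ x → v + 0 ≡ x
copied {v} eq = trans (+-identityʳ v) eq

-- Invariants such as `x + k * s` reduce to `x + 0` before the first pass.
start : ∀ {v x : ℕ} → v ≡ x → v ≡ x + 0
start {x = x} eq = trans eq (sym (+-identityʳ x))

-- `%nears` and `%ptrs` are the starts of two tables with a cell for each row: its closeness to the
-- nearest centre, and the address of the products of that centre. `%near` and `%ptr` walk through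
-- them. `%out` is the first free cell, `%product` the start of the products made in the current
-- round, and `%cand` and `%best` describe the farthest row seen so far in a scan.
%q %p %r %ℓ %a %aRow %aCol %b %bRow %bCol %oRow %oCol %nears %ptrs %out %centre : Reg
%rounds %outer %inner %product %cand %best %col %row %near %ptr %pa %pb %acc %x %y %t : Reg
%q       = 1
%p       = 6
%r       = 7
%ℓ       = 8
%a       = 9
%aRow    = 10
%aCol    = 11
%b       = 12
%bRow    = 13
%bCol    = 14
%oRow    = 15
%oCol    = 16
%nears   = 17
%ptrs    = 18
%out     = 19
%centre  = 20
%rounds  = 21
%outer   = 22
%inner   = 23
%product = 24
%cand    = 25
%best    = 26
%col     = 27
%row     = 28
%near    = 29
%ptr     = 30
%pa      = 31
%pb      = 32
%acc     = 33
%x       = 34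
%y       = 35
%t       = 36

-- For bits x and y, x ∸ (1 ∸ y) is their product.
dotLoop : Cmd
dotLoop = for %inner $ ops $
  load %x %pa ∷ load %y %pb ∷ sub %y one %y ∷ sub %x %x %y ∷ add %acc %acc %x ∷
  add %pa %pa %aCol ∷ add %pb %pb %bRow ∷ []

dotLoop-ends : ∀ {b R M n α β sα sβ} {f g : ℕ → ℕ} →
  R one ≡ 1 → R %aCol ≡ sα → R %bRow ≡ sβ → R %inner ≡ n → R %pa ≡ α → R %pb ≡ β → R %acc ≡ 0 →
  (∀ h → h < n → M (α + h * sα) ≡ f h) → (∀ h → h < n → M (β + h * sβ) ≡ g h) →
  (∀ h → h < n → f h ≤ 1) → α + n * sα ≤ b → β + n * sβ ≤ b → n ≤ b →
  Ends b dotLoop (R , M) (forCost n 7)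
    (λ (R′ , M′) → R′ %acc ≡ ∑ n (λ h → f h ∸ (1 ∸ g h)) × M′ ≡ M)
dotLoop-ends {b} {R} {M} {n} {α} {β} {sα} {sβ} {f} {g} eone eα eβ en epa epb eacc fs gs f≤1 α≤b β≤b n≤b =
  ends-weaken ≤-refl (λ (R′ , M′) _ (_ , _ , eacc′ , eM) → eacc′ , eM) $
  ends-for I (λ ()) tt tt en eone (start epa , start epb , eacc , refl) λ where
    k (R′ , M′) k<n same (epa′ , epb′ , eacc′ , refl) →
      let ex : M (R′ %pa) ∸ (R′ one ∸ M (R′ %pb)) ≡ F k
          ex = cong₂ _∸_ (trans (cong M epa′) (fs k k<n))
                 (cong₂ _∸_ (trans (same one tt) eone) (trans (cong M epb′) (gs k k<n)))
          esum = cong₂ _+_ eacc′ ex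
          ea = stride k epa′ (trans (same %aCol tt) eα)
          eb = stride k epb′ (trans (same %bRow tt) eβ)
          -- The accumulator is a sum of two registers and needs its own bound: each of its terms is
          -- at most 1.
          sum≤ = ≤-trans (∑-≤ (suc k) λ h h≤k → ≤-trans (m∸n≤m (f h) (1 ∸ g h)) (f≤1 h (≤-trans h≤k k<n)))
                   (≤-trans k<n n≤b)
      in ends-ops _
           ( _ , _ , _ , _ , subst (_≤ b) (sym esum) sum≤
           , subst (_≤ b) (sym ea) (≤-trans (+-monoʳ-≤ α (*-monoˡ-≤ sα k<n)) α≤b)
           , subst (_≤ b) (sym eb) (≤-trans (+-monoʳ-≤ β (*-monoˡ-≤ sβ k<n)) β≤b) , _)
           (ea , eb , esum , refl)
  where
  F : ℕ → ℕ
  F h = f h ∸ (1 ∸ g h)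
  I : ℕ → Store → Set
  I k (R′ , M′) = R′ %pa ≡ α + k * sα × R′ %pb ≡ β + k * sβ × R′ %acc ≡ ∑ k F × M′ ≡ M

-- The absolute difference, split into the two truncated subtractions that the machine offers; on
-- bits it tells whether they differ.
gap : (ℕ → ℕ) → (ℕ → ℕ) → ℕ → ℕ
gap f g h = (f h ∸ g h) + (g h ∸ f h)

-- The accumulator is lowered, not raised: started at `suc q` in `scan`, it ends as a closeness, and
-- subtractions need no bound on their results.
hamLoop : Cmd
hamLoop = for %inner $ ops $
  load %x %pa ∷ load %y %pb ∷ sub %t %x %y ∷ sub %y %y %x ∷ sub %acc %acc %t ∷ sub %acc %acc %y ∷
  add %pa %pa %aCol ∷ add %pb %pb %aCol ∷ []

hamLoop-ends : ∀ {b R M n α β s c} {f g : ℕ → ℕ} →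
  R one ≡ 1 → R %aCol ≡ s → R %inner ≡ n → R %pa ≡ α → R %pb ≡ β → R %acc ≡ c →
  (∀ h → h < n → M (α + h * s) ≡ f h) → (∀ h → h < n → M (β + h * s) ≡ g h) →
  α + n * s ≤ b → β + n * s ≤ b →
  Ends b hamLoop (R , M) (forCost n 8)
    (λ (R′ , M′) → R′ %acc ≡ c ∸ ∑ n (gap f g) × M′ ≡ M)
hamLoop-ends {b} {R} {M} {n} {α} {β} {s} {c} {f} {g} eone es en epa epb eacc fs gs α≤b β≤b =
  ends-weaken ≤-refl (λ (R′ , M′) _ (_ , _ , eacc′ , eM) → eacc′ , eM) $
  ends-for I (λ ()) tt tt en eone (start epa , start epb , eacc , refl) λ where
    k (R′ , M′) k<n same (epa′ , epb′ , eacc′ , refl) →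
      let ef = trans (cong M epa′) (fs k k<n)
          eg = trans (cong M epb′) (gs k k<n)
          ea = stride k epa′ (trans (same %aCol tt) es)
          eb = stride k epb′ (trans (same %aCol tt) es)
      in ends-ops _
           ( _ , _ , _ , _ , _ , _
           , subst (_≤ b) (sym ea) (≤-trans (+-monoʳ-≤ α (*-monoˡ-≤ s k<n)) α≤b)
           , subst (_≤ b) (sym eb) (≤-trans (+-monoʳ-≤ β (*-monoˡ-≤ s k<n)) β≤b) , _)
           (ea , eb , trans (cong₂ _∸_ (cong₂ _∸_ eacc′ (cong₂ _∸_ ef eg)) (cong₂ _∸_ eg ef)) (collect k) , refl)
  where
  collect : ∀ k → c ∸ ∑ k (gap f g) ∸ (f k ∸ g k) ∸ (g k ∸ f k) ≡ c ∸ ∑ (suc k) (gap f g)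
  collect k = trans (∸-+-assoc (c ∸ ∑ k (gap f g)) (f k ∸ g k) (g k ∸ f k))
    (∸-+-assoc c (∑ k (gap f g)) (gap f g k))
  I : ℕ → Store → Set
  I k (R′ , M′) = R′ %pa ≡ α + k * s × R′ %pb ≡ β + k * s × R′ %acc ≡ c ∸ ∑ k (gap f g) × M′ ≡ M

-- The values are closenesses, so the larger one survives. In the first case the row keeps its
-- centre, in the second it moves to the new one together with the pointer.
Updated : (old oldPtr new newPtr candidate candidatePtr : ℕ) → Set
Updated n t n′ t′ c w = (n′ ≡ n × c ≤ n × t′ ≡ t) ⊎ (n′ ≡ c × n ≤ c × t′ ≡ w)

update : Cmd
update = ops (load %x %near ∷ sub %t %acc %x ∷ [])
       ⨾ if %t (ops (store %near %acc ∷ store %ptr %product ∷ []))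

update-ends : ∀ {b R M ν τ} → R %near ≡ ν → R %ptr ≡ τ → ν ≢ τ →
  Ends b update (R , M) 5
    (λ (R′ , M′) → Updated (M ν) (M τ) (M′ ν) (M′ τ) (R %acc) (R %product)
                 × (∀ x → x ≢ ν → x ≢ τ → M′ x ≡ M x))
update-ends {b} {R} {M} refl refl ν≢τ = ends-ops⨾ _ _ $ ends-if
  (λ t≡0 → inj₁ (refl , m∸n≡0⇒m≤n t≡0 , refl) , λ _ _ _ → refl)
  λ t≢0 → ends-ops _ _ $
    inj₂ ( trans (≔-other (M [ R %near ≔ R %acc ]) ν≢τ) (≔-same M refl)
         , <⇒≤ (m∸n≢0⇒n<m t≢0) , ≔-same (M [ R %near ≔ R %acc ]) {R %ptr} refl)
    , λ x x≢ν x≢τ → trans (≔-other (M [ R %near ≔ R %acc ]) x≢τ) (≔-other M x≢ν)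

elect : Cmd
elect = ops (load %x %near ∷ sub %t %best %x ∷ [])
        ⨾ if %t (ops (addi %best %x 0 ∷ addi %cand %row 0 ∷ []))

elect-ends : ∀ {b R M ν} → R %near ≡ ν →
  Ends b elect (R , M) 5
    (λ (R′ , M′) → M′ ≡ M × R′ %best ≤ M ν × R′ %best ≤ R %best
      × ((R′ %best ≡ R %best × R′ %cand ≡ R %cand) ⊎ (R′ %best ≡ M ν × R′ %cand ≡ R %row)))
elect-ends {b} {R} {M} refl = ends-ops⨾ _ _ $ ends-if
  (λ t≡0 → refl , m∸n≡0⇒m≤n t≡0 , ≤-refl , inj₁ (refl , refl))
  λ t≢0 → ends-ops _ _ $
    let e = +-identityʳ (M (R %near)) in
    refl , ≤-reflexive e , ≤-trans (≤-reflexive e) (<⇒≤ (m∸n≢0⇒n<m t≢0)) , inj₂ (e , +-identityʳ (R %row))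

-- Fixed before `main` starts and never written by it. Listing them lets one Boolean evaluation show
-- that a command preserves them all.
paramRegs : List Reg
paramRegs = %q ∷ one ∷ %p ∷ %r ∷ %ℓ ∷ %a ∷ %aRow ∷ %aCol ∷ %b ∷ %bRow ∷ %bCol ∷ %oRow ∷ %oCol
          ∷ %nears ∷ %ptrs ∷ []

lookupᵇ : ∀ {Q : ℕ → Set} {xs} → All Q xs → ∀ x {_ : T (any (x ≡ᵇ_) xs)} → Q x
lookupᵇ {Q} {y ∷ _} (z ∷ zs) x {t} with x ≡ᵇ y in e
... | true  = subst Q (sym (≡ᵇ⇒≡ x y (subst T (sym e) tt))) z
... | false = lookupᵇ zs x {t}

Holds : (Reg → ℕ) → Store → Set
Holds ρ (R , M) = All (λ x → R x ≡ ρ x) paramRegs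

holds-keep : ∀ {ρ σ τ} c {_ : T (all (λ x → not (writes c x)) paramRegs)} → Same c σ τ →
             Holds ρ σ → Holds ρ τ
holds-keep {ρ} {σ} {τ} c {t} same = go t
  where
  go : ∀ {xs} → T (all (λ x → not (writes c x)) xs) →
       All (λ x → proj₁ σ x ≡ ρ x) xs → All (λ x → proj₁ τ x ≡ ρ x) xs
  go _ [] = []
  go {x ∷ xs} t (z ∷ zs) with not (writes c x) in e
  ... | true = trans (same x (subst T (sym e) tt)) z ∷ go t zs

-- The commands of the algorithm and their costs

productRow : Cmd
productRow = for %outer
  ( ops (addi %pa %centre 0 ∷ addi %pb %col 0 ∷ const %acc 0 ∷ addi %inner %q 0 ∷ [])
  ⨾ dotLoop
  ⨾ ops (store %out %acc ∷ addi %out %out 1 ∷ add %col %col %bCol ∷ []))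

scan : Cmd
scan = for %outer
  ( ops (addi %pa %row 0 ∷ addi %pb %centre 0 ∷ addi %acc %q 1 ∷ addi %inner %q 0 ∷ [])
  ⨾ hamLoop
  ⨾ update
  ⨾ elect
  ⨾ ops (addi %near %near 1 ∷ addi %ptr %ptr 1 ∷ add %row %row %aRow ∷ []))

rounds : Cmd
rounds = for %rounds
  ( ops (addi %product %out 0 ∷ addi %col %b 0 ∷ addi %outer %r 0 ∷ [])
  ⨾ productRow
  ⨾ ops (addi %row %a 0 ∷ addi %near %nears 0 ∷ addi %ptr %ptrs 0 ∷
         -- The value `q + 2` exceeds every closeness, so a full scan elects some row. It takes two
         -- steps because `Safe` limits immediates to 1.
         addi %best %q 1 ∷ addi %best %best 1 ∷ addi %outer %p 0 ∷ [])
  ⨾ scan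
  ⨾ ops (addi %centre %cand 0 ∷ []))

copyRow : Cmd
copyRow = for %inner $ ops $
  load %x %pa ∷ store %pb %x ∷ addi %pa %pa 1 ∷ add %pb %pb %oCol ∷ []

-- While centres change only pointers move. Each row of the result is written once, in time of order
-- `p * r` altogether.
copy : Cmd
copy = ops (addi %row %out 0 ∷ addi 0 %out 0 ∷ addi %ptr %ptrs 0 ∷ addi %outer %p 0 ∷ [])
  ⨾ for %outer
    ( ops (load %pa %ptr ∷ addi %pb %row 0 ∷ addi %inner %r 0 ∷ [])
    ⨾ copyRow
    ⨾ ops (addi %ptr %ptr 1 ∷ add %row %row %oRow ∷ []))

main : Cmd
main = rounds ⨾ copy

productCost : ℕ → ℕ → ℕ
productCost q r = forCost r (4 + (forCost q 7 + 3))

scanCost : ℕ → ℕ → ℕ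
scanCost p q = forCost p (4 + (forCost q 8 + (5 + (5 + 3))))

roundsCost : ℕ → ℕ → ℕ → ℕ → ℕ
roundsCost p q r ℓ = forCost ℓ (3 + (productCost q r + (6 + (scanCost p q + 1))))

copyCost : ℕ → ℕ → ℕ
copyCost p r = 4 + forCost p (3 + (forCost r 4 + 2))

-- Entry (i , h) of the clustered matrix is stored at a + i * aRow + h * aCol,
-- entry (h , j) of the other one at b + j * bCol + h * bRow, and entry (i , j) of
-- the result at O + i * oRow + j * oCol.  With these strides one program serves
-- both the given matrices and their transposes.
module Farthest
  (p q r ℓ a aRow aCol b bRow bCol oRow oCol N : ℕ) (M₀ : ℕ → ℕ) (bound : ℕ)
  where

  A : ℕ → ℕ → ℕ
  A i h = M₀ (a + i * aRow + h * aCol)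

  B : ℕ → ℕ → ℕ
  B j h = M₀ (b + j * bCol + h * bRow)

  dot : ℕ → ℕ → ℕ
  dot i j = ∑ q (λ h → A i h ∸ (1 ∸ B j h))

  dist : ℕ → ℕ → ℕ
  dist i c = ∑ q (gap (A i) (A c))

  -- Closeness instead of distance, so that the initial zeros of the memory
  -- mean that there is no centre yet.
  close : ℕ → ℕ → ℕ
  close i c = suc q ∸ dist i c

  -- Memory map: the input below `N`, then `p` closenesses, `p` pointers, `ℓ` rows of products and
  -- the result.
  ptrs products O : ℕ
  ptrs     = N + p
  products = ptrs + p
  O        = products + ℓ * r

  -- The numerals are the registers of `paramRegs`, in the same order.
  ρ : Reg → ℕ
  ρ 1  = q
  ρ 5  = 1
  ρ 6  = p
  ρ 7  = r
  ρ 8  = ℓ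
  ρ 9  = a
  ρ 10 = aRow
  ρ 11 = aCol
  ρ 12 = b
  ρ 13 = bRow
  ρ 14 = bCol
  ρ 15 = oRow
  ρ 16 = oCol
  ρ 17 = N
  ρ 18 = ptrs
  ρ _  = 0

  Params : Store → Set
  Params = Holds ρ

  record Layout : Set where
    field
      1≤p     : 1 ≤ p
      1≤ℓ     : 1 ≤ ℓ
      A-low   : ∀ {i h} → i < p → h < q → a + i * aRow + h * aCol < N
      B-low   : ∀ {j h} → j < r → h < q → b + j * bCol + h * bRow < N
      A-bit   : ∀ {i h} → i < p → h < q → A i h ≤ 1
      -- Pointers are advanced once more after their last use, so these bounds reach a stride past
      -- the last entry.
      A-bound : a + p * aRow + q * aCol ≤ bound
      B-bound : b + r * bCol + q * bRow ≤ bound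
      O-bound : O + p * oRow + r * oCol ≤ bound
      q-bound : q ≤ bound
      empty   : ∀ {x} → N ≤ x → M₀ x ≡ 0
      O-inj   : ∀ {i i′ j j′} → i < p → i′ < p → j < r → j′ < r →
                i * oRow + j * oCol ≡ i′ * oRow + j′ * oCol → i ≡ i′ × j ≡ j′

  module _ (layout : Layout) where
    open Layout layout

    A-end : ∀ {i} → i < p → a + i * aRow + q * aCol ≤ bound
    A-end i<p = ≤-trans (+-monoˡ-≤ (q * aCol) (+-monoʳ-≤ a (*-monoˡ-≤ aRow (<⇒≤ i<p)))) A-bound

    B-end : ∀ {j} → j < r → b + j * bCol + q * bRow ≤ bound
    B-end j<r = ≤-trans (+-monoˡ-≤ (q * bRow) (+-monoʳ-≤ b (*-monoˡ-≤ bCol (<⇒≤ j<r)))) B-bound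

    A-next : ∀ {i} → i < p → a + suc i * aRow ≤ bound
    A-next i<p = ≤-trans (+-monoʳ-≤ a (*-monoˡ-≤ aRow i<p)) (≤-trans (m≤m+n _ (q * aCol)) A-bound)

    B-next : ∀ {j} → j < r → b + suc j * bCol ≤ bound
    B-next j<r = ≤-trans (+-monoʳ-≤ b (*-monoˡ-≤ bCol j<r)) (≤-trans (m≤m+n _ (q * bRow)) B-bound)

    -- Invariants of a round

    ProductRow : (ℕ → ℕ) → ℕ → ℕ → Set
    ProductRow M w c = ∀ j → j < r → M (w + j) ≡ dot c j

    productRow-ends : ∀ {R M c w} → Params (R , M) → c < p → R %centre ≡ a + c * aRow → R %out ≡ w →
      R %col ≡ b → R %outer ≡ r → N ≤ w → (∀ x → x < N → M x ≡ M₀ x) →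
      Ends bound productRow (R , M) (productCost q r)
        (λ (R′ , M′) → R′ %out ≡ w + r × ProductRow M′ w c × (∀ x → x < w → M′ x ≡ M x))
    productRow-ends {R} {M} {c} {w} par c<p ecentre eout ecol eouter N≤w low =
      ends-weaken ≤-refl (λ _ _ (_ , eout′ , rows , same-low) → eout′ , rows , same-low) $
      ends-for I (λ ()) tt tt eouter (lookupᵇ par one) (start ecol , start eout , (λ _ ()) , λ _ _ → refl)
        λ where
        j τ@(R′ , M′) j<r same (ecol′ , eout′ , rows , same-low) →
          let par′ : Params τ
              par′ = holds-keep {ρ} {R , M} {τ} productRow same par
              read : ∀ x → x < N → M′ x ≡ M₀ x
              read x x<N = trans (same-low x (<-≤-trans x<N N≤w)) (low x x<N)
          in ends-ops⨾ _ _ $ ends-seq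
            (dotLoop-ends (lookupᵇ par′ one) (lookupᵇ par′ %aCol) (lookupᵇ par′ %bRow)
              (copied (lookupᵇ par′ %q)) (copied (trans (same %centre tt) ecentre)) (copied ecol′) refl
              (λ h h<q → read _ (A-low c<p h<q)) (λ h h<q → read _ (B-low j<r h<q))
              (λ h h<q → A-bit c<p h<q) (A-end c<p) (B-end j<r) q-bound)
            λ (R₂ , M₂) same₂ → λ where
              (eacc , refl) →
                let eout₂ = trans (same₂ %out tt) eout′
                    ecol₂ = stride j (trans (same₂ %col tt) ecol′)
                              (trans (same₂ %bCol tt) (lookupᵇ par′ %bCol))
                    keep : ∀ {x} → x < w + j → (M′ [ R₂ %out ≔ R₂ %acc ]) x ≡ M′ x
                    keep x< = ≔-other M′ λ x≡ → <⇒≢ x< (trans x≡ eout₂)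
                in ends-ops _
                     (_ , _ , subst (_≤ bound) (sym ecol₂) (B-next j<r) , _)
                     ( ecol₂ , next eout₂
                     , (λ j′ j′≤j → case-row j′≤j rows keep (trans (≔-same M′ (sym eout₂)) eacc))
                     , λ x x<w → trans (keep (≤-trans x<w (m≤m+n w j))) (same-low x x<w))
      where
      I : ℕ → Store → Set
      I j (R′ , M′) = R′ %col ≡ b + j * bCol × R′ %out ≡ w + j
                    × (∀ j′ → j′ < j → M′ (w + j′) ≡ dot c j′) × (∀ x → x < w → M′ x ≡ M x)
      case-row : ∀ {j j′} {M₁ M₂ : ℕ → ℕ} → j′ < suc j → (∀ i → i < j → M₁ (w + i) ≡ dot c i) →
        (∀ {x} → x < w + j → M₂ x ≡ M₁ x) → M₂ (w + j) ≡ dot c j → M₂ (w + j′) ≡ dot c j′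
      case-row {j} {j′} j′≤j rows keep eq with m≤n⇒m<n∨m≡n (s≤s⁻¹ j′≤j)
      ... | inj₁ j′<j = trans (keep (+-monoʳ-< w j′<j)) (rows j′ j′<j)
      ... | inj₂ refl = eq

    Untouched : ℕ → ℕ → Set
    Untouched i x = ∀ k → k < i → x ≢ N + k × x ≢ ptrs + k

    near<ptrs : ∀ {i k} → i < p → N + i < ptrs + k
    near<ptrs {k = k} i<p = <-≤-trans (+-monoʳ-< N i<p) (m≤m+n ptrs k)

    untouched-near : ∀ {i} → i < p → Untouched i (N + i)
    untouched-near i<p k k<i =
      (λ eq → <⇒≢ k<i (sym (+-cancelˡ-≡ N _ k eq))) , <⇒≢ (near<ptrs i<p)

    untouched-ptr : ∀ {i} → i < p → Untouched i (ptrs + i)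
    untouched-ptr i<p k k<i =
      (λ eq → <⇒≢ (near<ptrs (<-trans k<i i<p)) (sym eq)) , λ eq → <⇒≢ k<i (sym (+-cancelˡ-≡ ptrs _ k eq))

    untouched-low : ∀ {i x} → x < N → Untouched i x
    untouched-low x<N k _ =
      <⇒≢ (<-≤-trans x<N (m≤m+n N k)) , <⇒≢ (<-≤-trans x<N (≤-trans (m≤m+n N p) (m≤m+n ptrs k)))

    untouched-high : ∀ {x} → products ≤ x → Untouched p x
    untouched-high le k k<p =
        (λ eq → <⇒≢ (<-≤-trans (near<ptrs k<p) le) (sym eq))
      , (λ eq → <⇒≢ (<-≤-trans (+-monoʳ-< ptrs k<p) le) (sym eq))

    -- `M₁` is the memory before the scan, `c` the new centre and `w` the address of its products.
    -- The first alternative of `elected` means that no row is elected yet; `round-step` refutes it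
    -- after a full scan, since closenesses are at most `suc q`.
    record Scanned (M₁ : ℕ → ℕ) (c w i : ℕ) (σ : Store) : Set where
      constructor scanned
      R = proj₁ σ
      M = proj₂ σ
      field
        at-row  : R %row ≡ a + i * aRow
        at-near : R %near ≡ N + i
        at-ptr  : R %ptr ≡ ptrs + i
        kept    : ∀ x → Untouched i x → M x ≡ M₁ x
        updated : ∀ k → k < i →
                  Updated (M₁ (N + k)) (M₁ (ptrs + k)) (M (N + k)) (M (ptrs + k)) (close k c) w
        least   : ∀ k → k < i → R %best ≤ M (N + k)
        elected : R %best ≡ 2 + q ⊎ ∃[ m ] m < i × R %cand ≡ a + m * aRow × R %best ≡ M (N + m)

    scanned-step : ∀ {M₁ c w i R M R′ M′} → Scanned M₁ c w i (R , M) → i < p →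
      Updated (M (N + i)) (M (ptrs + i)) (M′ (N + i)) (M′ (ptrs + i)) (close i c) w →
      (∀ x → x ≢ N + i → x ≢ ptrs + i → M′ x ≡ M x) →
      R′ %row ≡ a + suc i * aRow → R′ %near ≡ N + suc i → R′ %ptr ≡ ptrs + suc i →
      R′ %best ≤ M′ (N + i) → R′ %best ≤ R %best →
      (R′ %best ≡ R %best × R′ %cand ≡ R %cand) ⊎ (R′ %best ≡ M′ (N + i) × R′ %cand ≡ a + i * aRow) →
      Scanned M₁ c w (suc i) (R′ , M′)
    scanned-step {M₁} {c} {w} {i} {R} {M} {R′} {M′} inv i<p up others
        at-row at-near at-ptr best≤near best≤best choice =
      scanned at-row at-near at-ptr kept′ updated′ least′ (elected′ choice)
      where
      open Scanned inv using (kept; updated; least; elected)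
      old-near : ∀ k → k < i → M′ (N + k) ≡ M (N + k)
      old-near k k<i = others (N + k) (λ eq → <⇒≢ k<i (+-cancelˡ-≡ N k i eq)) (<⇒≢ (near<ptrs (<-trans k<i i<p)))
      old-ptr : ∀ k → k < i → M′ (ptrs + k) ≡ M (ptrs + k)
      old-ptr k k<i = others (ptrs + k) (λ eq → <⇒≢ (near<ptrs i<p) (sym eq))
        (λ eq → <⇒≢ k<i (+-cancelˡ-≡ ptrs k i eq))
      kept′ : ∀ x → Untouched (suc i) x → M′ x ≡ M₁ x
      kept′ x un = let n , t = un i ≤-refl in
        trans (others x n t) (kept x λ k k<i → un k (m<n⇒m<1+n k<i))
      updated′ : ∀ k → k < suc i →
        Updated (M₁ (N + k)) (M₁ (ptrs + k)) (M′ (N + k)) (M′ (ptrs + k)) (close k c) w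
      updated′ k k≤i with m≤n⇒m<n∨m≡n (s≤s⁻¹ k≤i)
      ... | inj₁ k<i rewrite old-near k k<i | old-ptr k k<i = updated k k<i
      ... | inj₂ refl rewrite sym (kept (N + i) (untouched-near i<p)) | sym (kept (ptrs + i) (untouched-ptr i<p)) = up
      least′ : ∀ k → k < suc i → R′ %best ≤ M′ (N + k)
      least′ k k≤i with m≤n⇒m<n∨m≡n (s≤s⁻¹ k≤i)
      ... | inj₁ k<i rewrite old-near k k<i = ≤-trans best≤best (least k k<i)
      ... | inj₂ refl = best≤near
      elected′ : (R′ %best ≡ R %best × R′ %cand ≡ R %cand) ⊎ (R′ %best ≡ M′ (N + i) × R′ %cand ≡ a + i * aRow) →
        R′ %best ≡ 2 + q ⊎ ∃[ m ] m < suc i × R′ %cand ≡ a + m * aRow × R′ %best ≡ M′ (N + m)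
      elected′ (inj₂ (eb , ec)) = inj₂ (i , ≤-refl , ec , eb)
      elected′ (inj₁ (eb , ec)) with elected
      ... | inj₁ e = inj₁ (trans eb e)
      ... | inj₂ (m , m<i , em , bm) =
        inj₂ (m , m<n⇒m<1+n m<i , trans ec em , trans eb (trans bm (sym (old-near m m<i))))

    scan-ends : ∀ {R M c w} → Params (R , M) → c < p → R %centre ≡ a + c * aRow → R %product ≡ w →
      R %row ≡ a → R %near ≡ N → R %ptr ≡ ptrs → R %best ≡ 2 + q → R %outer ≡ p →
      (∀ x → x < N → M x ≡ M₀ x) → Ends bound scan (R , M) (scanCost p q) (Scanned M c w p)
    scan-ends {R} {M} {c} {w} par c<p ecentre eproduct erow enear eptr ebest eouter low =
      ends-for (Scanned M c w) (λ ()) tt tt eouter (lookupᵇ par one)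
        (scanned (start erow) (start enear) (start eptr) (λ _ _ → refl) (λ _ ()) (λ _ ()) (inj₁ ebest)) λ where
        i τ@(R′ , M′) i<p same inv@(scanned at-row at-near at-ptr kept updated least elected) →
          let par′ : Params τ
              par′ = holds-keep {ρ} {R , M} {τ} scan same par
              read : ∀ x → x < N → M′ x ≡ M₀ x
              read x x<N = trans (kept x (untouched-low x<N)) (low x x<N)
          in ends-ops⨾ _ _ $ ends-seq
            (hamLoop-ends {c = suc q} (lookupᵇ par′ one) (lookupᵇ par′ %aCol) (copied (lookupᵇ par′ %q))
              (copied at-row) (copied (trans (same %centre tt) ecentre))
              (trans (+-comm (R′ %q) 1) (cong suc (lookupᵇ par′ %q)))
              (λ h h<q → read _ (A-low i<p h<q)) (λ h h<q → read _ (A-low c<p h<q))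
              (A-end i<p) (A-end c<p))
            λ (R₂ , M₂) same₂ → λ where
              (eacc , refl) → ends-seq
                (update-ends (trans (same₂ %near tt) at-near) (trans (same₂ %ptr tt) at-ptr)
                  (<⇒≢ (near<ptrs i<p)))
                λ (R₃ , M₃) same₃ → λ (up , others) → ends-seq
                  (elect-ends (trans (same₃ %near tt) (trans (same₂ %near tt) at-near)))
                  λ (R₄ , M₄) same₄ → λ where
                    (refl , best≤near , best≤best , choice) →
                      let keep = λ x t₂ t₃ t₄ → trans (same₄ x t₄) (trans (same₃ x t₃) (same₂ x t₂))
                          at-row₄ = stride i (trans (keep %row tt tt tt) at-row)
                                      (trans (keep %aRow tt tt tt) (lookupᵇ par′ %aRow))
                          at-near₄ = trans (keep %near tt tt tt) at-near
                          at-ptr₄  = trans (keep %ptr tt tt tt) at-ptr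
                          cand′ = map₂ λ (e , e′) → e ,
                                    trans e′ (trans (same₃ %row tt) (trans (same₂ %row tt) at-row))
                          best₃ = trans (same₃ %best tt) (same₂ %best tt)
                          cand₃ = trans (same₃ %cand tt) (same₂ %cand tt)
                      in ends-ops _ (_ , _ , subst (_≤ bound) (sym at-row₄) (A-next i<p) , _)
                           (scanned-step inv i<p
                             (subst₂ (Updated _ _ _ _) eacc
                               (trans (same₂ %product tt) (trans (same %product tt) eproduct)) up)
                             others at-row₄ (next at-near₄) (next at-ptr₄) best≤near
                             (≤-trans best≤best (≤-reflexive best₃))
                             (map₁ (λ (e , e′) → trans e best₃ , trans e′ cand₃) (cand′ choice)))

    -- The value 0 marks a row without a centre. Otherwise its products lie between `products` and
    -- `w`: above the tables that scans write to, and below the cells that later rounds fill.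
    Assigned : (ℕ → ℕ) → ℕ → ℕ → Set
    Assigned M w i = M (N + i) ≡ 0 ⊎ ∃[ c ] c < p × M (N + i) ≡ close i c
      × products ≤ M (ptrs + i) × M (ptrs + i) + r ≤ w × ProductRow M (M (ptrs + i)) c

    -- The list of centres is extended by the one which the next round uses.
    record Round (t : ℕ) (σ : Store) : Set where
      constructor round
      R = proj₁ σ
      M = proj₂ σ
      field
        {centres}  : List ℕ
        {centre}   : ℕ
        count      : length centres ≡ t
        are-rows   : All (_< p) (centre ∷ centres)
        at-centre  : R %centre ≡ a + centre * aRow
        at-out     : R %out ≡ products + t * r
        low        : ∀ x → x < N → M x ≡ M₀ x
        assigned   : ∀ i → i < p → Assigned M (products + t * r) i
        nearest    : ∀ i → i < p → All (λ u → close i u ≤ M (N + i)) centres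
        -- The farthest-first property: chosen rows are at least as far from each other as any row
        -- is from its nearest centre.
        separated  : ∀ i → i < p → AllPairs (λ v u → close v u ≤ M (N + i)) (centre ∷ centres)

    ptrs+<products : ∀ {i} → i < p → ptrs + i < products
    ptrs+<products i<p = +-monoʳ-< ptrs i<p

    N+<products : ∀ {i} → i < p → N + i < products
    N+<products {i} i<p = <-trans (near<ptrs {k = i} i<p) (ptrs+<products i<p)

    -- Stored closenesses never decrease (`mono`), so old pairs stay separated. The elected row has
    -- the least stored closeness, and this bounds its closeness to every centre, which separates
    -- the new pairs.
    round-step : ∀ {t R M M₂ R₃ M₃ R′} (inv : Round t (R , M)) →
      (∀ x → x < products + t * r → M₂ x ≡ M x) → ProductRow M₂ (products + t * r) (Round.centre inv) →
      Scanned M₂ (Round.centre inv) (products + t * r) p (R₃ , M₃) →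
      R′ %centre ≡ R₃ %cand → R′ %out ≡ products + suc t * r → Round (suc t) (R′ , M₃)
    round-step {t} {R} {M} {M₂} {R₃} {M₃} {R′} (round {cs} {s} count (s<p ∷ cs<p) _ _ low assigned nearest separated)
      same row sc ecentre eout = conclude (Scanned.elected sc)
      where
      open Scanned sc using (kept; updated; least)
      w w′ : ℕ
      w  = products + t * r
      w′ = products + suc t * r
      w+r : w + r ≡ w′
      w+r = stride {x = products} {r} t refl refl
      products≤w : products ≤ w
      products≤w = m≤m+n products (t * r)
      old-near : ∀ {i} → i < p → M₂ (N + i) ≡ M (N + i)
      old-near i<p = same _ (<-≤-trans (N+<products i<p) products≤w)
      old-ptr : ∀ {i} → i < p → M₂ (ptrs + i) ≡ M (ptrs + i)
      old-ptr i<p = same _ (<-≤-trans (ptrs+<products i<p) products≤w)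
      update-at : ∀ {i} → i < p →
        Updated (M (N + i)) (M (ptrs + i)) (M₃ (N + i)) (M₃ (ptrs + i)) (close i s) w
      update-at {i} i<p = subst₂ (λ n t → Updated n t (M₃ (N + i)) (M₃ (ptrs + i)) (close i s) w)
        (old-near i<p) (old-ptr i<p) (updated i i<p)
      high : ∀ x → products ≤ x → M₃ x ≡ M₂ x
      high x le = kept x (untouched-high le)
      assigned′ : ∀ i → i < p → Assigned M₃ w′ i
      assigned′ i i<p with update-at i<p
      ... | inj₂ (n≡ , _ , t≡) rewrite t≡ = inj₂ (s , s<p , n≡ , products≤w , ≤-reflexive w+r ,
        λ j j<r → trans (high _ (≤-trans products≤w (m≤m+n w j))) (row j j<r))
      ... | inj₁ (n≡ , _ , t≡) with assigned i i<p
      ...   | inj₁ n≡0 = inj₁ (trans n≡ n≡0)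
      ...   | inj₂ (c , c<p , n≡c , lo , hi , rowc) rewrite t≡ = inj₂ (c , c<p , trans n≡ n≡c , lo ,
        ≤-trans hi (≤-trans (m≤m+n w r) (≤-reflexive w+r)) ,
        λ j j<r → trans (high _ (≤-trans lo (m≤m+n _ j)))
          (trans (same _ (<-≤-trans (+-monoʳ-< (M (ptrs + i)) j<r) hi)) (rowc j j<r)))
      mono : ∀ i → i < p → M (N + i) ≤ M₃ (N + i)
      mono i i<p with update-at i<p
      ... | inj₁ (n≡ , _)      = ≤-reflexive (sym n≡)
      ... | inj₂ (n≡ , le , _) = ≤-trans le (≤-reflexive (sym n≡))
      near-s : ∀ i → i < p → close i s ≤ M₃ (N + i)
      near-s i i<p with update-at i<p
      ... | inj₁ (n≡ , le , _) = ≤-trans le (≤-reflexive (sym n≡))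
      ... | inj₂ (n≡ , _)      = ≤-reflexive (sym n≡)
      nearest′ : ∀ i → i < p → All (λ u → close i u ≤ M₃ (N + i)) (s ∷ cs)
      nearest′ i i<p = near-s i i<p ∷ All.map (λ le → ≤-trans le (mono i i<p)) (nearest i i<p)
      near≤ : ∀ i → i < p → M₃ (N + i) ≤ suc q
      near≤ i i<p with assigned′ i i<p
      ... | inj₁ n≡0               = ≤-trans (≤-reflexive n≡0) z≤n
      ... | inj₂ (c , _ , n≡c , _) = ≤-trans (≤-reflexive n≡c) (m∸n≤m (suc q) (dist i c))
      conclude : R₃ %best ≡ 2 + q ⊎ ∃[ m ] m < p × R₃ %cand ≡ a + m * aRow × R₃ %best ≡ M₃ (N + m) →
                 Round (suc t) (R′ , M₃)
      conclude (inj₁ eq) = contradiction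
        (≤-trans (≤-reflexive (sym eq)) (≤-trans (least 0 1≤p) (near≤ 0 1≤p))) (<⇒≱ ≤-refl)
      conclude (inj₂ (m , m<p , em , bm)) = round (cong suc count) (m<p ∷ s<p ∷ cs<p) (trans ecentre em) eout
        (λ x x<N → trans (kept x (untouched-low x<N)) (trans (same x (<-≤-trans x<N N≤w)) (low x x<N)))
        assigned′ nearest′
        λ i i<p → All.map (λ le → ≤-trans le (≤-trans (≤-reflexive (sym bm)) (least i i<p))) (nearest′ m m<p)
          ∷ AllPairs.map (λ le → ≤-trans le (mono i i<p)) (separated i i<p)
        where
        N≤w : N ≤ w
        N≤w = ≤-trans (≤-trans (m≤m+n N p) (m≤m+n ptrs p)) products≤w

    rounds-ends : ∀ {R} → Params (R , M₀) → R %out ≡ products → R %centre ≡ a → R %rounds ≡ ℓ →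
                  Ends bound rounds (R , M₀) (roundsCost p q r ℓ) (Round ℓ)
    rounds-ends {R} par eout ecentre erounds = ends-for Round (λ ()) tt tt erounds (lookupᵇ par one)
      -- Row 0 is the first centre, and `1≤p` makes it a row. No centre is finished yet, so the
      -- closenesses are the zeros of the empty memory.
      (round {centre = 0} refl (1≤p ∷ []) (start ecentre) (start eout) (λ _ _ → refl)
        (λ i _ → inj₁ (empty (m≤m+n N i))) (λ _ _ → []) (λ _ _ → [] ∷ []))
      λ where
      t τ@(R′ , M′) t<ℓ same inv@(round _ (s<p ∷ _) at-centre at-out low _ _ _) →
        let par′ : Params τ
            par′ = holds-keep {ρ} {R , M₀} {τ} rounds same par
            is₁ = addi %product %out 0 ∷ addi %col %b 0 ∷ addi %outer %r 0 ∷ []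
            par₁ : Params (acts is₁ τ)
            par₁ = holds-keep {ρ} {τ} {acts is₁ τ} (ops is₁) (acts-same {0} is₁ {τ} _) par′
        in ends-ops⨾ _ _ $ ends-seq
          (productRow-ends par₁ s<p at-centre at-out (copied (lookupᵇ par′ %b)) (copied (lookupᵇ par′ %r))
            (≤-trans (≤-trans (m≤m+n N p) (m≤m+n ptrs p)) (m≤m+n products (t * r))) low)
          λ τ₂@(R₂ , M₂) same₂ → λ (out₂ , row , same-low) →
            let par₂ : Params τ₂
                par₂ = holds-keep {ρ} {acts is₁ τ} {τ₂} productRow same₂ par₁
                is₂ = addi %row %a 0 ∷ addi %near %nears 0 ∷ addi %ptr %ptrs 0 ∷
                      addi %best %q 1 ∷ addi %best %best 1 ∷ addi %outer %p 0 ∷ []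
                par₃ : Params (acts is₂ τ₂)
                par₃ = holds-keep {ρ} {τ₂} {acts is₂ τ₂} (ops is₂) (acts-same {0} is₂ {τ₂} _) par₂
            in ends-ops⨾ _ _ $ ends-seq
              (scan-ends par₃ s<p (trans (same₂ %centre tt) at-centre)
                (trans (same₂ %product tt) (copied at-out)) (copied (lookupᵇ par₂ %a))
                (copied (lookupᵇ par₂ %nears)) (copied (lookupᵇ par₂ %ptrs))
                (trans (+-comm (R₂ %q + 1) 1) (cong suc (trans (+-comm (R₂ %q) 1) (cong suc (lookupᵇ par₂ %q)))))
                (copied (lookupᵇ par₂ %p))
                λ x x<N → trans (same-low x (<-≤-trans x<N
                  (≤-trans (≤-trans (m≤m+n N p) (m≤m+n ptrs p)) (m≤m+n products (t * r))))) (low x x<N))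
              λ (R₃ , M₃) same₃ sc → ends-ops _ _
                (round-step inv same-low row sc (+-identityʳ (R₃ %cand))
                  (trans (same₃ %out tt) (trans out₂ (stride {x = products} {r} t refl refl))))

    -- Copying products into the result

    addr : ℕ → ℕ → ℕ
    addr i j = O + i * oRow + j * oCol

    addr-inj : ∀ {i i′ j j′} → i < p → i′ < p → j < r → j′ < r → addr i j ≡ addr i′ j′ → i ≡ i′ × j ≡ j′
    addr-inj {i} {i′} i<p i′<p j<r j′<r eq = O-inj i<p i′<p j<r j′<r
      (+-cancelˡ-≡ O _ _ (trans (sym (+-assoc O (i * oRow) _)) (trans eq (+-assoc O (i′ * oRow) _))))

    O≤addr : ∀ {i j} → O ≤ addr i j
    O≤addr {i} {j} = ≤-trans (m≤m+n O (i * oRow)) (m≤m+n _ (j * oCol))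

    Copied : (M₁ M : ℕ → ℕ) → ℕ → ℕ → Set
    Copied M₁ M i j = ∀ i′ j′ → i′ < p → j′ < r → i′ < i ⊎ (i′ ≡ i × j′ < j) →
                      M (addr i′ j′) ≡ M₁ (M₁ (ptrs + i′) + j′)

    copy-cell : ∀ {M₁ M i j v} → Copied M₁ M i j → i < p → j < r → v ≡ M₁ (M₁ (ptrs + i) + j) →
                Copied M₁ (M [ addr i j ≔ v ]) i (suc j)
    copy-cell {M₁} {M} {i} {j} cop i<p j<r ev i′ j′ i′<p j′<r before with addr i′ j′ ≟ addr i j
    ... | yes eq with refl , refl ← addr-inj i′<p i<p j′<r j<r eq = trans (≔-same M eq) ev
    ... | no ne = trans (≔-other M ne) (cop i′ j′ i′<p j′<r (earlier before))
      where
      earlier : i′ < i ⊎ (i′ ≡ i × j′ < suc j) → i′ < i ⊎ (i′ ≡ i × j′ < j)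
      earlier (inj₁ i′<i) = inj₁ i′<i
      earlier (inj₂ (refl , j′≤j)) with m≤n⇒m<n∨m≡n (s≤s⁻¹ j′≤j)
      ... | inj₁ j′<j = inj₂ (refl , j′<j)
      ... | inj₂ refl = contradiction refl ne

    -- Everything read lies below `O` and everything written at `O` or above, so copying destroys
    -- nothing that is still to be read.
    copyRow-ends : ∀ {R M M₁ i} → Params (R , M) → i < p → R %pa ≡ M₁ (ptrs + i) →
      R %pb ≡ O + i * oRow → R %inner ≡ r → (∀ x → x < O → M x ≡ M₁ x) → Copied M₁ M i 0 →
      M₁ (ptrs + i) + r ≤ O →
      Ends bound copyRow (R , M) (forCost r 4)
        (λ (R′ , M′) → (∀ x → x < O → M′ x ≡ M₁ x) × Copied M₁ M′ i r)
    copyRow-ends {R} {M} {M₁} {i} par i<p epa epb einner low cop hi =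
      ends-weaken ≤-refl (λ _ _ (_ , _ , low′ , cop′) → low′ , cop′) $
      ends-for I (λ ()) tt tt einner (lookupᵇ par one) (start epa , start epb , low , cop) λ where
        j (R′ , M′) j<r same (epa′ , epb′ , low′ , cop′) →
          let epb″ = stride j epb′ (trans (same %oCol tt) (lookupᵇ par %oCol))
              value : M′ (R′ %pa) ≡ M₁ (M₁ (ptrs + i) + j)
              value = trans (cong M′ epa′) (low′ _ (<-≤-trans (+-monoʳ-< (M₁ (ptrs + i)) j<r) hi))
              O≤pb : O ≤ R′ %pb
              O≤pb = ≤-trans (O≤addr {i} {j}) (≤-reflexive (sym epb′))
          in ends-ops _
               ( _ , _ , _ , subst (_≤ bound) (sym epb″)
                   (≤-trans (+-mono-≤ (+-monoʳ-≤ O (*-monoˡ-≤ oRow (<⇒≤ i<p))) (*-monoˡ-≤ oCol j<r)) O-bound) , _)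
               ( next epa′ , epb″
               , (λ x x<O → trans (≔-other M′ (<⇒≢ (<-≤-trans x<O O≤pb))) (low′ x x<O))
               , subst (λ z → Copied M₁ (M′ [ z ≔ M′ (R′ %pa) ]) i (suc j)) (sym epb′)
                   (copy-cell {M₁} {M′} cop′ i<p j<r value))
      where
      I : ℕ → Store → Set
      I j (R′ , M′) = R′ %pa ≡ M₁ (ptrs + i) + j × R′ %pb ≡ O + i * oRow + j * oCol
                    × (∀ x → x < O → M′ x ≡ M₁ x) × Copied M₁ M′ i j

    copy-ends : ∀ {R M} → Params (R , M) → R %out ≡ O → (∀ i → i < p → M (ptrs + i) + r ≤ O) →
      Ends bound copy (R , M) (copyCost p r)
        (λ (R′ , M′) → R′ 0 ≡ O × (∀ i j → i < p → j < r → M′ (addr i j) ≡ M (M (ptrs + i) + j)))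
    copy-ends {R} {M} par eout hi =
      ends-ops⨾ _ _ $ ends-weaken ≤-refl (λ (R′ , _) same (_ , _ , _ , cop) →
        trans (same 0 tt) (copied eout) , λ i j i<p j<r → cop i j i<p j<r (inj₁ i<p)) $
      ends-for I (λ ()) tt tt (copied (lookupᵇ par %p)) (lookupᵇ par one)
        (start (copied eout) , start (copied (lookupᵇ par %ptrs)) , (λ _ _ → refl)
        , λ { _ _ _ _ (inj₁ ()) ; _ _ _ _ (inj₂ (_ , ())) })
        λ where
        i τ@(R′ , M′) i<p same (erow , eptr , low , cop) →
          let is₁ = addi %row %out 0 ∷ addi 0 %out 0 ∷ addi %ptr %ptrs 0 ∷ addi %outer %p 0 ∷ []
              par₀ : Params (acts is₁ (R , M))
              par₀ = holds-keep {ρ} {R , M} {acts is₁ (R , M)} (ops is₁) (acts-same {0} is₁ {R , M} _) par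
              par₁ : Params τ
              par₁ = holds-keep {ρ} {acts is₁ (R , M)} {τ} loop same par₀
              is₂ = load %pa %ptr ∷ addi %pb %row 0 ∷ addi %inner %r 0 ∷ []
              par₂ : Params (acts is₂ τ)
              par₂ = holds-keep {ρ} {τ} {acts is₂ τ} (ops is₂) (acts-same {0} is₂ {τ} _) par₁
          in ends-ops⨾ _ _ $ ends-seq
            (copyRow-ends {M₁ = M} par₂ i<p
              (trans (cong M′ eptr) (low _ (<-≤-trans (ptrs+<products i<p) (m≤m+n products (ℓ * r)))))
              (copied erow) (copied (lookupᵇ par₁ %r)) low cop (hi i i<p))
            λ (R₂ , M₂) same₂ → λ (low₂ , cop₂) →
              let erow₂ = stride i (trans (same₂ %row tt) erow) (trans (same₂ %oRow tt) (lookupᵇ par₁ %oRow))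
              in ends-ops _
                   ( _ , subst (_≤ bound) (sym erow₂)
                       (≤-trans (+-monoʳ-≤ O (*-monoˡ-≤ oRow i<p)) (≤-trans (m≤m+n _ (r * oCol)) O-bound)) , _)
                   ( erow₂ , next (trans (same₂ %ptr tt) eptr) , low₂
                   , λ i′ j′ i′<p j′<r before → cop₂ i′ j′ i′<p j′<r (row-done j′<r before))
      where
      loop : Cmd
      loop = for %outer
        ( ops (load %pa %ptr ∷ addi %pb %row 0 ∷ addi %inner %r 0 ∷ [])
        ⨾ copyRow
        ⨾ ops (addi %ptr %ptr 1 ∷ add %row %row %oRow ∷ []))
      I : ℕ → Store → Set
      I i (R′ , M′) = R′ %row ≡ O + i * oRow × R′ %ptr ≡ ptrs + i × (∀ x → x < O → M′ x ≡ M x) × Copied M M′ i 0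
      row-done : ∀ {i i′ j′} → j′ < r → i′ < suc i ⊎ (i′ ≡ suc i × j′ < 0) → i′ < i ⊎ (i′ ≡ i × j′ < r)
      row-done j′<r (inj₁ i′≤i) with m≤n⇒m<n∨m≡n (s≤s⁻¹ i′≤i)
      ... | inj₁ i′<i = inj₁ i′<i
      ... | inj₂ eq   = inj₂ (eq , j′<r)

    -- Every row is represented by a nearest centre

    gap-≤1 : ∀ {f g : ℕ → ℕ} {h} → f h ≤ 1 → g h ≤ 1 → gap f g h ≤ 1
    gap-≤1 {f} {g} {h} f≤1 g≤1 with f h | g h
    gap-≤1 z≤n       z≤n       | _ | _ = z≤n
    gap-≤1 z≤n       (s≤s z≤n) | _ | _ = s≤s z≤n
    gap-≤1 (s≤s z≤n) z≤n       | _ | _ = s≤s z≤n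
    gap-≤1 (s≤s z≤n) (s≤s z≤n) | _ | _ = z≤n

    dist-≤ : ∀ {i c} → i < p → c < p → dist i c ≤ q
    dist-≤ {i} {c} i<p c<p = ∑-≤ q λ h h<q → gap-≤1 {A i} {A c} {h} (A-bit i<p h<q) (A-bit c<p h<q)

    close-pos : ∀ {i c} → i < p → c < p → 0 < close i c
    close-pos i<p c<p = m<n⇒0<n∸m (s≤s (dist-≤ i<p c<p))

    -- The row c stands in for the row i, and no two of the rows i ∷ cs are
    -- closer to each other than i and c.
    record Represented (M : ℕ → ℕ) (i : ℕ) : Set where
      constructor represented
      field
        {c}    : ℕ
        {cs}   : List ℕ
        c<p    : c < p
        output : ∀ j → j < r → M (addr i j) ≡ dot c j
        count  : length cs ≡ ℓ
        rows   : All (_< p) (i ∷ cs)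
        far    : AllPairs (λ v u → dist i c ≤ dist v u) (i ∷ cs)

    -- As `ℓ` is positive there is a centre, and its closeness to row `i` is positive because
    -- distances are at most `q`. This rules out the value 0.
    assigned-centre : ∀ {R M i} → Round ℓ (R , M) → i < p →
      ∃[ c ] c < p × M (N + i) ≡ close i c × products ≤ M (ptrs + i)
           × M (ptrs + i) + r ≤ O × ProductRow M (M (ptrs + i)) c
    assigned-centre {i = i} inv i<p with Round.assigned inv i i<p
    ... | inj₂ good = good
    ... | inj₁ n≡0 with inv
    ...   | round {[]} refl _ _ _ _ _ _ _ = contradiction 1≤ℓ λ ()
    ...   | round {u ∷ _} _ (_ ∷ u<p ∷ _) _ _ _ _ nearest _ with le ∷ _ ← nearest i i<p =
      contradiction (<-≤-trans (close-pos i<p u<p) (≤-trans le (≤-reflexive n≡0))) λ ()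

    main-ends : ∀ {R} → Params (R , M₀) → R %out ≡ products → R %centre ≡ a → R %rounds ≡ ℓ →
      Ends bound main (R , M₀) (roundsCost p q r ℓ + copyCost p r)
        (λ (R′ , M′) → R′ 0 ≡ O × (∀ i → i < p → Represented M′ i))
    main-ends {R} par eout ecentre erounds = ends-seq (rounds-ends par eout ecentre erounds)
      λ τ@(R₁ , M₁) same inv → ends-weaken ≤-refl
        (λ (R₂ , M₂) _ (e0 , cop) → e0 , λ i i<p → represent inv i<p (λ j j<r → cop i j i<p j<r)) $
      copy-ends (holds-keep {ρ} {R , M₀} {τ} rounds same par) (Round.at-out inv)
        λ i i<p → let _ , _ , _ , _ , hi , _ = assigned-centre inv i<p in hi
      where
      represent : ∀ {R₁ M₁ M₂ i} → Round ℓ (R₁ , M₁) → i < p →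
        (∀ j → j < r → M₂ (addr i j) ≡ M₁ (M₁ (ptrs + i) + j)) → Represented M₂ i
      represent {M₁ = M₁} {i = i} inv@(round count (_ ∷ cs<p) _ _ _ _ nearest separated) i<p cop
        with c , c<p , n≡ , _ , _ , row ← assigned-centre inv i<p
        -- The row elected in the last round is dropped; row `i` takes its place as the extra point
        -- beside the `ℓ` centres.
        with _ ∷ sep ← separated i i<p
        = represented c<p (λ j j<r → trans (cop j j<r) (row j j<r)) count (i<p ∷ cs<p)
            (All.map (λ {u} → far i u) (nearest i i<p) ∷ AllPairs.map (λ {v} {u} → far v u) sep)
        where
        far : ∀ v u → close v u ≤ M₁ (N + i) → dist i c ≤ dist v u
        -- Closeness reverses the order of distances faithfully here because `dist i c` does not
        -- exceed `suc q`, so nothing is truncated on its side.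
        far v u le = ∸-cancelʳ-≤ (m≤n⇒m≤1+n (dist-≤ i<p c<p)) (≤-trans le (≤-reflexive n≡))

-- Hamming distances and separated points

-- `∑` grows at its end like an accumulating loop, whereas vectors are taken apart at the front.
∑-front : ∀ n f → ∑ (suc n) f ≡ f 0 + ∑ n (f ∘ suc)
∑-front zero    f = sym (+-identityʳ (f 0))
∑-front (suc n) f = trans (cong (_+ f (suc n)) (∑-front n f)) (+-assoc (f 0) _ _)

∑-sum : ∀ n {F : Fin n → ℕ} {f} → (∀ h → F h ≡ f (toℕ h)) → Vec.sum (tabulate F) ≡ ∑ n f
∑-sum zero        eq = refl
∑-sum (suc n) {f = f} eq =
  trans (cong₂ _+_ (eq zero) (∑-sum n (eq ∘ suc))) (sym (∑-front n f))

ham-∑ : ∀ {q} (x y : Point q) {f g : ℕ → ℕ} → (∀ h → toℕ (lookup x h) ≡ f (toℕ h)) →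
        (∀ h → toℕ (lookup y h) ≡ g (toℕ h)) → ham x y ≡ ∑ q (gap f g)
ham-∑ []       []       ex ey = refl
ham-∑ {suc q} (x ∷ xs) (y ∷ ys) {f} {g} ex ey =
  trans (count-∷ x y)
    (trans (cong₂ _+_ (cong₂ _+_ (cong₂ _∸_ (ex zero) (ey zero)) (cong₂ _∸_ (ey zero) (ex zero)))
      (ham-∑ xs ys {f ∘ suc} {g ∘ suc} (ex ∘ suc) (ey ∘ suc))) (sym (∑-front q (gap f g))))
  where
  count-∷ : ∀ x y → ham (x ∷ xs) (y ∷ ys) ≡ ((toℕ x ∸ toℕ y) + (toℕ y ∸ toℕ x)) + ham xs ys
  count-∷ zero       zero       = refl
  count-∷ zero       (suc zero) = refl
  count-∷ (suc zero) zero       = refl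
  count-∷ (suc zero) (suc zero) = refl

ham-triangle : ∀ {q} (x y u : Point q) → ham x y ≤ ham x u + ham y u
ham-triangle []       []       []       = z≤n
ham-triangle (x ∷ xs) (y ∷ ys) (u ∷ us) = cons x y u
  where
  ih = ham-triangle xs ys us
  m+1+n = +-suc (ham xs us) (ham ys us)
  cons : ∀ x y u → ham (x ∷ xs) (y ∷ ys) ≤ ham (x ∷ xs) (u ∷ us) + ham (y ∷ ys) (u ∷ us)
  cons zero       zero       zero       = ih
  cons zero       zero       (suc zero) = m≤n⇒m≤1+n (≤-trans ih (+-monoʳ-≤ (ham xs us) (n≤1+n _)))
  cons zero       (suc zero) zero       = ≤-trans (s≤s ih) (≤-reflexive (sym m+1+n))
  cons zero       (suc zero) (suc zero) = s≤s ih
  cons (suc zero) zero       zero       = s≤s ih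
  cons (suc zero) zero       (suc zero) = ≤-trans (s≤s ih) (≤-reflexive (sym m+1+n))
  cons (suc zero) (suc zero) zero       = m≤n⇒m≤1+n (≤-trans ih (+-monoʳ-≤ (ham xs us) (n≤1+n _)))
  cons (suc zero) (suc zero) (suc zero) = ih

ham-≤ : ∀ {q} (x y : Point q) → ham x y ≤ q
ham-≤ []       []       = z≤n
ham-≤ (x ∷ xs) (y ∷ ys) = cons x y
  where
  ih = ham-≤ xs ys
  cons : ∀ x y → ham (x ∷ xs) (y ∷ ys) ≤ suc _
  cons zero       zero       = m≤n⇒m≤1+n ih
  cons zero       (suc zero) = s≤s ih
  cons (suc zero) zero       = s≤s ih
  cons (suc zero) (suc zero) = m≤n⇒m≤1+n ih

entry-transpose : ∀ {X : Set} {m n} (M : Matrix X m n) i j → entry (transpose M) j i ≡ entry M i j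
entry-transpose {n = n} (row ∷ rows) i j = trans (cong (λ col → lookup col i) column) (cell i)
  where
  column : lookup (transpose (row ∷ rows)) j ≡ lookup row j ∷ lookup (transpose rows) j
  column = trans (lookup-⊛ j (Vec._⊛_ (Vec.replicate n _∷_) row) (transpose rows))
    (cong (_$ lookup (transpose rows) j)
      (trans (lookup-⊛ j (Vec.replicate n _∷_) row) (cong (_$ lookup row j) (lookup-replicate j _∷_))))
  cell : ∀ i → lookup (lookup row j ∷ lookup (transpose rows) j) i ≡ entry (row ∷ rows) i j
  cell zero    = refl
  cell (suc i) = entry-transpose rows i j

∑-mono : ∀ n {f g : ℕ → ℕ} → (∀ h → h < n → f h ≤ g h) → ∑ n f ≤ ∑ n g
∑-mono zero    le = z≤n
∑-mono (suc n) le = +-mono-≤ (∑-mono n λ h h<n → le h (m<n⇒m<1+n h<n)) (le n ≤-refl)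

∑-+ : ∀ n f g → ∑ n (λ h → f h + g h) ≡ ∑ n f + ∑ n g
∑-+ zero    f g = refl
∑-+ (suc n) f g = begin
  ∑ n (λ h → f h + g h) + (f n + g n)  ≡⟨ cong (_+ (f n + g n)) (∑-+ n f g) ⟩
  (∑ n f + ∑ n g) + (f n + g n)        ≡⟨ +-assoc (∑ n f) (∑ n g) _ ⟩
  ∑ n f + (∑ n g + (f n + g n))        ≡⟨ cong (∑ n f +_) (x∙yz≈y∙xz +-commutativeSemigroup (∑ n g) (f n) (g n)) ⟩
  ∑ n f + (f n + (∑ n g + g n))        ≡⟨ +-assoc (∑ n f) (f n) _ ⟨
  (∑ n f + f n) + (∑ n g + g n)        ∎
  where
  open ≡-Reasoning

∣-∣-bound : ∀ {m n d} → m ≤ n + d → n ≤ m + d → ∣ m - n ∣ ≤ d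
∣-∣-bound {m} {n} le ge with ∣m-n∣≡[m∸n]∨[n∸m] m n
... | inj₁ eq = ≤-trans (≤-reflexive eq) (m≤n+o⇒m∸n≤o m n le)
... | inj₂ eq = ≤-trans (≤-reflexive eq) (m≤n+o⇒m∸n≤o n m ge)

-- Termwise: if `k h` is 0, both terms vanish because `g h ≤ 1`; if it is 1, they are `f h` and
-- `g h`. The second sum is what `dotLoop` computes for a representing row.
dot-error : ∀ n {f g k : ℕ → ℕ} → (∀ h → h < n → g h ≤ 1) → (∀ h → h < n → k h ≤ 1) →
            ∣ ∑ n (λ h → f h * k h) - ∑ n (λ h → g h ∸ (1 ∸ k h)) ∣ ≤ ∑ n (gap f g)
dot-error n {f} {g} {k} g≤1 k≤1 = ∣-∣-bound
  (≤-trans (∑-mono n λ h h<n → above (f h) (k≤1 h h<n)) (≤-reflexive (∑-+ n _ _)))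
  (≤-trans (∑-mono n λ h h<n → below (f h) (g≤1 h h<n) (k≤1 h h<n)) (≤-reflexive (∑-+ n _ _)))
  where
  above : ∀ x {y z} → z ≤ 1 → x * z ≤ (y ∸ (1 ∸ z)) + ((x ∸ y) + (y ∸ x))
  above x z≤n rewrite *-zeroʳ x = z≤n
  above x {y} (s≤s z≤n) rewrite *-identityʳ x =
    ≤-trans (m≤n+m∸n x y) (+-monoʳ-≤ y (m≤m+n (x ∸ y) (y ∸ x)))
  below : ∀ x {y z} → y ≤ 1 → z ≤ 1 → y ∸ (1 ∸ z) ≤ x * z + ((x ∸ y) + (y ∸ x))
  below x y≤1 z≤n = ≤-trans (≤-reflexive (m≤n⇒m∸n≡0 y≤1)) z≤n
  below x {y} _ (s≤s z≤n) rewrite *-identityʳ x =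
    ≤-trans (m≤n+m∸n y x) (+-monoʳ-≤ x (m≤n+m (y ∸ x) (x ∸ y)))

AllPairs-lookup : ∀ {X : Set} {R : X → X → Set} {xs} → AllPairs R xs → ∀ i j → i Fin.< j →
                  R (List.lookup xs i) (List.lookup xs j)
AllPairs-lookup (r ∷ _)  zero    (suc j) _         = All.lookup r (∈ₗ-lookup j)
AllPairs-lookup (_ ∷ rs) (suc i) (suc j) (s≤s i<j) = AllPairs-lookup rs i j i<j

choose-length : ∀ {X : Set} n (xs : List X) {T} → T ∈ choose n xs → length T ≡ n
choose-length zero    xs       (here refl) = refl
choose-length (suc n) (x ∷ xs) T∈ with ∈-++⁻ (List.map (x ∷_) (choose n xs)) T∈
... | inj₂ T∈′ = choose-length (suc n) xs T∈′
... | inj₁ T∈′ with _ , S∈ , refl ← ∈-map⁻ (x ∷_) T∈′ = cong suc (choose-length n xs S∈)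

-- A minimum is attained in the list or equals its starting value `q`, and `s < q` excludes the
-- latter.
near-centre : ∀ {q s} (x : Point q) T → distance x T ≤ s → s < q → Any (λ u → ham x u ≤ s) T
near-centre {q} {s} x T le s<q with argmin-sel id q (List.map (ham x) T)
... | inj₁ eq = contradiction (≤-trans (≤-reflexive (sym eq)) le) (<⇒≱ s<q)
... | inj₂ d∈ with u , u∈T , eq ← ∈-map⁻ (ham x) d∈ =
  Any.map (λ { refl → ≤-trans (≤-reflexive (sym eq)) le }) u∈T

-- By the pigeonhole principle two of the points xs are close to the same
-- element of T.
separation≤2radius : ∀ {q s δ} {xs T : List (Point q)} → length T < length xs →
  All (λ x → Any (λ u → ham x u ≤ s) T) xs → AllPairs (λ x y → δ ≤ ham x y) xs → δ ≤ 2 * s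
separation≤2radius {s = s} {xs = xs} {T} fewer covered apart =
  let cover : ∀ i → Any (λ u → ham (List.lookup xs i) u ≤ s) T
      cover i = All.lookup covered (∈ₗ-lookup i)
      i , j , i<j , eq = Fin.pigeonhole fewer (λ i → Any.index (cover i))
      x = List.lookup xs i
      y = List.lookup xs j
      u = List.lookup T (Any.index (cover i))
  in begin
    _                  ≤⟨ AllPairs-lookup apart i j i<j ⟩
    ham x y            ≤⟨ ham-triangle x y u ⟩
    ham x u + ham y u  ≤⟨ +-mono-≤ (lookup-index (cover i))
                            (subst (λ z → ham y (List.lookup T z) ≤ s) (sym eq) (lookup-index (cover j))) ⟩
    s + s              ≡⟨ cong (s +_) (+-identityʳ s) ⟨
    2 * s              ∎
  where open ≤-Reasoning

-- If λ equals the starting value `q` or a radius of at least `q`, then `δ ≤ q` suffices. Otherwise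
-- it is the radius of a list `T` of `ℓ ⊓ 2 ^ q` points, fewer than the `suc ℓ` points of `xs`.
separation≤2λ : ∀ {p q ℓ δ} (X : Matrix01 p q) {xs : List (Point q)} → length xs ≡ suc ℓ → δ ≤ q →
  All (_∈ toList X) xs → AllPairs (λ x y → δ ≤ ham x y) xs → δ ≤ 2 * λ-row X ℓ
separation≤2λ {q = q} {ℓ} {δ} X {xs} len δ≤q rows apart
  with argmin-sel id q (List.map (radius (toList X)) (choose (ℓ ⊓ 2 ^ q) (points q)))
... | inj₁ eq rewrite eq = ≤-trans δ≤q (m≤m+n q _)
... | inj₂ λ∈ with T , T∈ , eq ← ∈-map⁻ (radius (toList X)) λ∈ rewrite eq with radius (toList X) T <? q
...   | no ≮q  = ≤-trans δ≤q (≤-trans (≮⇒≥ ≮q) (m≤m+n _ _))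
...   | yes <q = separation≤2radius
        (≤-trans (s≤s (≤-trans (≤-reflexive (choose-length _ (points q) T∈)) (m⊓n≤m ℓ (2 ^ q))))
          (≤-reflexive (sym len)))
        (All.map (λ {x} x∈ → near-centre x T (All.lookup distances≤ x∈) <q) rows)
        apart
  where
  distances≤ : All (λ a → distance a T ≤ radius (toList X) T) (toList X)
  distances≤ = All.map⁻ (xs≤max 0 (List.map (λ a → distance a T) (toList X)))

-- Bridge from the machine, where rows are numbers with a distance `d`, to points of the cube.
separation≤2λ-indexed : ∀ {p q ℓ δ is} (X : Matrix01 p q) {d : ℕ → ℕ → ℕ} →
  (∀ i c → d (toℕ i) (toℕ c) ≡ ham (lookup X i) (lookup X c)) → length is ≡ suc ℓ → δ ≤ q →
  All (_< p) is → AllPairs (λ v u → δ ≤ d v u) is → δ ≤ 2 * λ-row X ℓ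
separation≤2λ-indexed {p} {q} {δ = δ} X {d} ed len δ≤q is<p apart =
  separation≤2λ X (trans (length-reduce is<p) len) δ≤q (are-rows is<p) (are-apart is<p apart)
  where
  point : ∀ {i} → i < p → Point q
  point i<p = lookup X (fromℕ< i<p)
  length-reduce : ∀ {is} (is<p : All (_< p) is) → length (All.reduce point is<p) ≡ length is
  length-reduce []        = refl
  length-reduce (_ ∷ ps) = cong suc (length-reduce ps)
  are-rows : ∀ {is} (is<p : All (_< p) is) → All (_∈ toList X) (All.reduce point is<p)
  are-rows []         = []
  are-rows (i<p ∷ ps) = ∈-toList⁺ (∈-lookup (fromℕ< i<p) X) ∷ are-rows ps
  d≡ham : ∀ {v u} (v<p : v < p) (u<p : u < p) → d v u ≡ ham (point v<p) (point u<p)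
  d≡ham v<p u<p = subst₂ (λ v u → d v u ≡ ham (point v<p) (point u<p))
    (Fin.toℕ-fromℕ< v<p) (Fin.toℕ-fromℕ< u<p) (ed (fromℕ< v<p) (fromℕ< u<p))
  apart-from : ∀ {v us} (v<p : v < p) (us<p : All (_< p) us) → All (λ u → δ ≤ d v u) us →
               All (λ y → δ ≤ ham (point v<p) y) (All.reduce point us<p)
  apart-from v<p []         []        = []
  apart-from v<p (u<p ∷ ps) (le ∷ ls) = ≤-trans le (≤-reflexive (d≡ham v<p u<p)) ∷ apart-from v<p ps ls
  are-apart : ∀ {is} (is<p : All (_< p) is) → AllPairs (λ v u → δ ≤ d v u) is →
              AllPairs (λ x y → δ ≤ ham x y) (All.reduce point is<p)
  are-apart []         []         = []
  are-apart (i<p ∷ ps) (as ∷ ass) = apart-from i<p ps as ∷ are-apart ps ass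

-- The input and the running time

cells-lookup : ∀ {n} (v : Vec (Fin 2) n) ys i →
               cells (List.map toℕ (toList v) ++ ys) (toℕ i) ≡ toℕ (lookup v i)
cells-lookup (x ∷ v) ys zero    = refl
cells-lookup (x ∷ v) ys (suc i) = cells-lookup v ys i

cells-skip : ∀ {n} (v : Vec (Fin 2) n) ys y →
             cells (List.map toℕ (toList v) ++ ys) (n + y) ≡ cells ys y
cells-skip []      ys y = refl
cells-skip (x ∷ v) ys y = cells-skip v ys y

cells-end : ∀ xs {x} → length xs ≤ x → cells xs x ≡ 0
cells-end []       _        = refl
cells-end (_ ∷ xs) (s≤s le) = cells-end xs le

cells-bit : ∀ {n} (v : Vec (Fin 2) n) {ys} → (∀ x → cells ys x ≤ 1) →
            ∀ x → cells (List.map toℕ (toList v) ++ ys) x ≤ 1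
cells-bit []               le x       = le x
cells-bit (zero     ∷ v)   le zero    = z≤n
cells-bit (suc zero ∷ v)   le zero    = ≤-refl
cells-bit (_        ∷ v)   le (suc x) = cells-bit v le x

cells-rowMajor : ∀ {m n} (X : Matrix01 m n) ys i j →
                 cells (rowMajor X ++ ys) (toℕ i * n + toℕ j) ≡ toℕ (entry X i j)
cells-rowMajor {n = n} X ys i j = begin
  cells (rowMajor X ++ ys) (toℕ i * n + toℕ j)
    ≡⟨ cong (λ z → cells (rowMajor X ++ ys) (z + toℕ j)) (*-comm (toℕ i) n) ⟩
  cells (rowMajor X ++ ys) (n * toℕ i + toℕ j)
    ≡⟨ cong (cells (rowMajor X ++ ys)) (Fin.toℕ-combine i j) ⟨
  cells (rowMajor X ++ ys) (toℕ (Fin.combine i j))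
    ≡⟨ cells-lookup (concat X) ys (Fin.combine i j) ⟩
  toℕ (lookup (concat X) (Fin.combine i j))
    ≡⟨ cong toℕ (lookup-concat X i j) ⟩
  toℕ (entry X i j) ∎
  where open ≡-Reasoning

length-rowMajor : ∀ {m n} (X : Matrix01 m n) → length (rowMajor X) ≡ m * n
length-rowMajor X = trans (length-map toℕ (toList (concat X))) (length-toList (concat X))

rowMajor-< : ∀ {m n i j} → i < m → j < n → i * n + j < m * n
rowMajor-< {m} {n} {i} {j} i<m j<n = begin-strict
  i * n + j  <⟨ +-monoʳ-< (i * n) j<n ⟩
  i * n + n  ≡⟨ +-comm (i * n) n ⟩
  suc i * n  ≤⟨ *-monoˡ-≤ n i<m ⟩
  m * n      ∎
  where open ≤-Reasoning

rowMajor-inj : ∀ {m n i i′ j j′} → i < m → i′ < m → j < n → j′ < n →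
               i * n + j ≡ i′ * n + j′ → i ≡ i′ × j ≡ j′
rowMajor-inj {n = n} {i} {i′} {j} {j′} _ _ j<n j′<n eq with <-cmp i i′
... | tri≈ _ refl _ = refl , +-cancelˡ-≡ (i * n) j j′ eq
... | tri< i<i′ _ _ = contradiction eq (<⇒≢ (<-≤-trans (rowMajor-< i<i′ j<n) (m≤m+n (i′ * n) j′)))
... | tri> _ _ i′<i = contradiction (sym eq) (<⇒≢ (<-≤-trans (rowMajor-< i′<i j′<n) (m≤m+n (i * n) j)))

module Input {p q r : ℕ} (A : Matrix01 p q) (B : Matrix01 q r) where

  M₀ : ℕ → ℕ
  M₀ = cells (rowMajor A ++ rowMajor B)

  N : ℕ
  N = p * q + r * q

  M₀-A : ∀ i h → M₀ (toℕ i * q + toℕ h * 1) ≡ toℕ (entry A i h)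
  M₀-A i h = trans (cong (λ z → M₀ (toℕ i * q + z)) (*-identityʳ (toℕ h))) (cells-rowMajor A _ i h)

  B-address : ∀ j h → p * q + j * 1 + h * r ≡ p * q + (h * r + j)
  B-address j h = trans (+-assoc (p * q) (j * 1) (h * r))
    (cong (p * q +_) (trans (cong (_+ h * r) (*-identityʳ j)) (+-comm j (h * r))))

  M₀-B : ∀ j h → M₀ (p * q + toℕ j * 1 + toℕ h * r) ≡ toℕ (entry B h j)
  M₀-B j h = begin
    M₀ (p * q + toℕ j * 1 + toℕ h * r)         ≡⟨ cong M₀ (B-address (toℕ j) (toℕ h)) ⟩
    M₀ (p * q + (toℕ h * r + toℕ j))           ≡⟨ cells-skip (concat A) (rowMajor B) _ ⟩
    cells (rowMajor B) (toℕ h * r + toℕ j)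
      ≡⟨ cong (λ z → cells z (toℕ h * r + toℕ j)) (++-identityʳ (rowMajor B)) ⟨
    cells (rowMajor B ++ []) (toℕ h * r + toℕ j)  ≡⟨ cells-rowMajor B [] h j ⟩
    toℕ (entry B h j)                          ∎
    where open ≡-Reasoning

  M₀-bit : ∀ x → M₀ x ≤ 1
  M₀-bit = cells-bit (concat A) λ x → subst (λ z → cells z x ≤ 1) (++-identityʳ (rowMajor B))
    (cells-bit (concat B) {[]} (λ _ → z≤n) x)

  M₀-empty : ∀ {x} → N ≤ x → M₀ x ≡ 0
  M₀-empty {x} N≤x = cells-end (rowMajor A ++ rowMajor B) (≤-trans (≤-reflexive size≡N) N≤x)
    where
    size≡N : length (rowMajor A ++ rowMajor B) ≡ N
    size≡N = trans (length-++ (rowMajor A))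
      (cong₂ _+_ (length-rowMajor A) (trans (length-rowMajor B) (*-comm q r)))

  A-low : ∀ {i h} → i < p → h < q → i * q + h * 1 < N
  A-low {i} {h} i<p h<q = <-≤-trans
    (subst (λ z → i * q + z < p * q) (sym (*-identityʳ h)) (rowMajor-< i<p h<q)) (m≤m+n (p * q) (r * q))

  B-low : ∀ {j h} → j < r → h < q → p * q + j * 1 + h * r < N
  B-low {j} {h} j<r h<q = subst₂ (λ x y → x < p * q + y) (sym (B-address j h)) (*-comm q r)
    (+-monoʳ-< (p * q) (rowMajor-< h<q j<r))

  entry-⊗ : ∀ i j → entry (A ⊗ B) i j ≡
            ∑ q (λ h → M₀ (toℕ i * q + h * 1) * M₀ (p * q + toℕ j * 1 + h * r))
  entry-⊗ i j = trans (cong (λ row → lookup row j) (lookup∘tabulate _ i)) (trans (lookup∘tabulate _ j)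
    (∑-sum q λ h → sym (cong₂ _*_ (M₀-A i h) (M₀-B j h))))

  entry-transpose-B : ∀ j h → toℕ (entry (transpose B) j h) ≡ M₀ (p * q + toℕ j * 1 + toℕ h * r)
  entry-transpose-B j h = trans (cong toℕ (entry-transpose B h j)) (sym (M₀-B j h))

-- Leaves `p * q`, the address of `B`, in `%x` and the end of the input in `%acc`. The `p + r`
-- additions are affordable, as `p` and `r` are both at most `p * r`.
measure : Cmd
measure = ops (const one 1 ∷ addi %inner 0 0 ∷ [])
        ⨾ for %inner (ops (add %acc %acc %q ∷ []))
        ⨾ ops (addi %x %acc 0 ∷ addi %inner 2 0 ∷ [])
        ⨾ for %inner (ops (add %acc %acc %q ∷ []))

measureCost : ℕ → ℕ → ℕ
measureCost p r = 2 + (forCost p 1 + (2 + forCost r 1))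

accumulate-ends : ∀ {b R M n v q} → R one ≡ 1 → R %q ≡ q → R %inner ≡ n → R %acc ≡ v → v + n * q ≤ b →
  Ends b (for %inner (ops (add %acc %acc %q ∷ []))) (R , M) (forCost n 1)
    (λ (R′ , M′) → R′ %acc ≡ v + n * q × M′ ≡ M)
accumulate-ends {b} {M = M} {v = v} {q} eone eq einner eacc le =
  ends-for (λ k (R′ , M′) → R′ %acc ≡ v + k * q × M′ ≡ M) (λ ()) tt tt einner eone (start eacc , refl) λ where
    k (R′ , M′) k<n same (eacc′ , refl) →
      let e = stride k eacc′ (trans (same %q tt) eq) in
      ends-ops _ (subst (_≤ b) (sym e) (≤-trans (+-monoʳ-≤ v (*-monoˡ-≤ q k<n)) le) , _) (e , refl)

measure-ends : ∀ {b R M p q r} → R 0 ≡ p → R %q ≡ q → R 2 ≡ r → R %acc ≡ 0 → p * q + r * q ≤ b →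
  Ends b measure (R , M) (measureCost p r)
    (λ (R′ , M′) → R′ one ≡ 1 × R′ %x ≡ p * q × R′ %acc ≡ p * q + r * q × M′ ≡ M)
measure-ends {p = p} {q} {r} ep eq er eacc le = ends-ops⨾ _ _ $ ends-seq
  (accumulate-ends refl eq (copied ep) eacc (≤-trans (m≤m+n (p * q) (r * q)) le))
  λ _ same₁ → λ where
    (eacc₁ , refl) → ends-ops⨾ _ _ $ ends-weaken ≤-refl
      (λ _ same₂ → λ where
        (eacc₂ , refl) → trans (same₂ one tt) (same₁ one tt) , trans (same₂ %x tt) (copied eacc₁) , eacc₂ , refl) $
      accumulate-ends (same₁ one tt) (trans (same₁ %q tt) eq) (copied (trans (same₁ 2 tt) er)) eacc₁ le

finish : List Instr
finish =
  addi %nears %acc 0 ∷ add %ptrs %nears %p ∷ add %out %ptrs %p ∷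
  addi %centre %a 0 ∷ addi %rounds %ℓ 0 ∷ []

rowSettings colSettings : List Instr
rowSettings =
  addi %p 0 0 ∷ addi %r 2 0 ∷ addi %ℓ 3 0 ∷
  const %a 0 ∷ addi %aRow %q 0 ∷ const %aCol 1 ∷
  addi %b %x 0 ∷ addi %bRow 2 0 ∷ const %bCol 1 ∷
  addi %oRow 2 0 ∷ const %oCol 1 ∷ finish
colSettings =
  addi %p 2 0 ∷ addi %r 0 0 ∷ addi %ℓ 4 0 ∷
  addi %a %x 0 ∷ const %aRow 1 ∷ addi %aCol 2 0 ∷
  const %b 0 ∷ const %bRow 1 ∷ addi %bCol %q 0 ∷
  const %oRow 1 ∷ addi %oCol 2 0 ∷ finish

-- For q = 0 the time bound leaves no room for the rounds, but the memory,
-- which is empty then, already holds the result.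
program : List Instr → Cmd
program settings = if %q (measure ⨾ ops settings ⨾ main)

-- Cost estimates with explicit constants

record AtMost (κ m x : ℕ) : Set where
  constructor at-most
  field bound : x ≤ κ * m

infixr 6 _⊕_

-- The factors are indices of a record and get inferred, so an estimate shaped like a cost
-- expression adds up its own constant.
_⊕_ : ∀ {x y κ κ′ m} → AtMost κ m x → AtMost κ′ m y → AtMost (κ + κ′) m (x + y)
_⊕_ {κ = κ} {κ′} {m} (at-most le) (at-most le′) =
  at-most (≤-trans (+-mono-≤ le le′) (≤-reflexive (sym (*-distribʳ-+ m κ κ′))))

once : ∀ {x m} → x ≤ m → AtMost 1 m x
once le = at-most (≤-trans le (m≤m+n _ 0))

lit : ∀ {m} c → 1 ≤ m → AtMost c m c
lit c 1≤m = at-most (≤-trans (≤-reflexive (sym (*-identityʳ c))) (*-monoʳ-≤ c 1≤m))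

relax : ∀ {κ κ′ m m′ x} → κ ≤ κ′ → m ≤ m′ → AtMost κ m x → AtMost κ′ m′ x
relax κ≤κ′ m≤m′ (at-most le) = at-most (≤-trans le (*-mono-≤ κ≤κ′ m≤m′))

-- Of the 4, one pays for the final test and three for the overhead of a pass; `1 ≤ n′` and `1 ≤ m`
-- let the product absorb them.
forCost-≤ : ∀ {n n′ t κ m} → n ≤ n′ → 1 ≤ n′ → 1 ≤ m → AtMost κ m t →
            AtMost (4 + κ) (n′ * m) (forCost n t)
forCost-≤ {n} {n′} {t} {κ} {m} n≤n′ 1≤n′ 1≤m t≤ = at-most (begin
  1 + n * (3 + t)              ≤⟨ +-mono-≤ (*-mono-≤ 1≤n′ 1≤m) (*-mono-≤ n≤n′ (AtMost.bound (lit 3 1≤m ⊕ t≤))) ⟩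
  n′ * m + n′ * ((3 + κ) * m)  ≡⟨ cong (n′ * m +_) (x∙yz≈y∙xz *-commutativeSemigroup n′ (3 + κ) m) ⟩
  (4 + κ) * (n′ * m)           ∎)
  where
  open ≤-Reasoning

module Sizes {p q r ℓ : ℕ} (r≤p : r ≤ p) (1≤ℓ : 1 ≤ ℓ) (ℓ≤p : ℓ ≤ p) (1≤r : 1 ≤ r) where

  Z : ℕ
  Z = p * q * ℓ + p * r

  1≤p : 1 ≤ p
  1≤p = ≤-trans 1≤r r≤p

  factorʳ : ∀ {m n} → 1 ≤ m → n ≤ m * n
  factorʳ {m} {n} 1≤m = ≤-trans (≤-reflexive (sym (*-identityˡ n))) (*-monoˡ-≤ n 1≤m)

  factorˡ : ∀ {m n} → 1 ≤ n → m ≤ m * n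
  factorˡ {m} {n} 1≤n = ≤-trans (≤-reflexive (sym (*-identityʳ m))) (*-monoʳ-≤ m 1≤n)

  pr≤Z : p * r ≤ Z
  pr≤Z = m≤n+m (p * r) (p * q * ℓ)

  pqℓ≤Z : p * q * ℓ ≤ Z
  pqℓ≤Z = m≤m+n (p * q * ℓ) (p * r)

  p≤Z : p ≤ Z
  p≤Z = ≤-trans (factorˡ 1≤r) pr≤Z

  r≤Z : r ≤ Z
  r≤Z = ≤-trans r≤p p≤Z

  1≤Z : 1 ≤ Z
  1≤Z = ≤-trans 1≤p p≤Z

  pq≤Z : p * q ≤ Z
  pq≤Z = ≤-trans (factorˡ 1≤ℓ) pqℓ≤Z

  rq≤Z : r * q ≤ Z
  rq≤Z = ≤-trans (*-monoˡ-≤ q r≤p) pq≤Z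

  q≤Z : q ≤ Z
  q≤Z = ≤-trans (factorʳ 1≤p) pq≤Z

  ℓr≤Z : ℓ * r ≤ Z
  ℓr≤Z = ≤-trans (*-monoˡ-≤ r ℓ≤p) pr≤Z

  bounded : ∀ {κ x} → κ ≤ 8 → AtMost κ Z x → x ≤ 8 * Z
  bounded κ≤8 le = AtMost.bound (relax κ≤8 ≤-refl le)

  -- Both the products and the scan of a round are charged to `p * (q * 1)`, the former by `r ≤ p`.
  -- The factor 1 is the size assigned to loop bodies of constant cost.
  main-≤ : 1 ≤ q → AtMost 90 Z (roundsCost p q r ℓ + copyCost p r)
  main-≤ 1≤q = rounds-≤ ⊕ copy-≤
    where
    product-≤ : AtMost 22 (p * (q * 1)) (productCost q r)
    scan-≤ : AtMost 33 (p * (q * 1)) (scanCost p q)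
    1≤q₁ : 1 ≤ q * 1
    1≤q₁ = *-mono-≤ 1≤q ≤-refl
    1≤r₁ : 1 ≤ r * 1
    1≤r₁ = *-mono-≤ 1≤r ≤-refl
    1≤pq : 1 ≤ p * (q * 1)
    1≤pq = *-mono-≤ 1≤p 1≤q₁
    product-≤ = forCost-≤ r≤p 1≤p 1≤q₁
      (lit 4 1≤q₁ ⊕ forCost-≤ ≤-refl 1≤q ≤-refl (lit 7 ≤-refl) ⊕ lit 3 1≤q₁)
    scan-≤ = forCost-≤ ≤-refl 1≤p 1≤q₁
      (lit 4 1≤q₁ ⊕ forCost-≤ ≤-refl 1≤q ≤-refl (lit 8 ≤-refl) ⊕ lit 13 1≤q₁)
    rounds-≤ : AtMost 69 Z (roundsCost p q r ℓ)
    rounds-≤ = relax ≤-refl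
      (≤-trans (≤-reflexive (trans (*-comm ℓ _) (cong (λ z → p * z * ℓ) (*-identityʳ q)))) pqℓ≤Z)
      (forCost-≤ ≤-refl 1≤ℓ 1≤pq (lit 3 1≤pq ⊕ product-≤ ⊕ lit 6 1≤pq ⊕ scan-≤ ⊕ lit 1 1≤pq))
    copy-≤ : AtMost 21 Z (copyCost p r)
    copy-≤ = lit 4 1≤Z ⊕ relax ≤-refl (≤-trans (≤-reflexive (cong (p *_) (*-identityʳ r))) pr≤Z)
      (forCost-≤ ≤-refl 1≤p 1≤r₁ (lit 3 1≤r₁ ⊕ forCost-≤ ≤-refl 1≤r ≤-refl (lit 4 ≤-refl) ⊕ lit 2 1≤r₁))

  measure-≤ : ∀ {m n} → m ≤ Z → n ≤ Z → AtMost 14 Z (measureCost m n)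
  measure-≤ m≤Z n≤Z = lit 2 1≤Z ⊕ loop m≤Z ⊕ lit 2 1≤Z ⊕ loop n≤Z
    where
    loop : ∀ {n} → n ≤ Z → AtMost 5 Z (forCost n 1)
    loop n≤Z = relax ≤-refl (≤-reflexive (*-identityʳ Z)) (forCost-≤ n≤Z 1≤Z ≤-refl (lit 1 ≤-refl))

  -- The 1 is the test for `q = 0`, the 16 the length of either list of settings.
  program-≤ : ∀ {m n} → 1 ≤ q → m ≤ Z → n ≤ Z →
              AtMost 121 Z (suc (measureCost m n + (16 + (roundsCost p q r ℓ + copyCost p r))))
  program-≤ 1≤q m≤Z n≤Z = lit 1 1≤Z ⊕ measure-≤ m≤Z n≤Z ⊕ lit 16 1≤Z ⊕ main-≤ 1≤q

record Measured {p q r} (A : Matrix01 p q) (B : Matrix01 q r) (ℓ k : ℕ) (R : Reg → ℕ) : Set where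
  field
    in-p    : R 0 ≡ p
    in-q    : R %q ≡ q
    in-r    : R 2 ≡ r
    in-ℓ    : R 3 ≡ ℓ
    in-k    : R 4 ≡ k
    in-one  : R one ≡ 1
    in-size : R %x ≡ p * q
    in-end  : R %acc ≡ p * q + r * q

inputStore : ∀ {p q r} → Matrix01 p q → Matrix01 q r → ℕ → ℕ → Store
inputStore A B ℓ k = let s = input A B ℓ k in reg s , mem s

program-ends : ∀ {p q r ℓ k b n m Q} settings (A : Matrix01 p q) (B : Matrix01 q r) → p * q + r * q ≤ b →
  1 ≤ m → (1 ≤ q → suc (measureCost p r + (length settings + n)) ≤ m) →
  (q ≡ 0 → Q (inputStore A B ℓ k)) →
  (∀ R → Measured A B ℓ k R → AllSafe b settings (R , mem (input A B ℓ k))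
    × Ends b main (acts settings (R , mem (input A B ℓ k))) n Q) →
  Ends b (program settings) (inputStore A B ℓ k) m Q
program-ends {q = zero} settings A B N≤b 1≤m cost h₀ h = ends (skip refl) 1≤m (h₀ refl)
program-ends {q = suc q} settings A B N≤b 1≤m cost h₀ h =
  ends-weaken (cost (s≤s z≤n)) (λ _ _ post → post) $ ends-if (λ ()) λ _ →
  ends-seq (measure-ends refl refl refl refl N≤b) λ (R , _) same → λ where
    (e-one , e-x , e-acc , refl) →
      let safe , e = h R record
            { in-p = same 0 tt ; in-q = same %q tt ; in-r = same 2 tt ; in-ℓ = same 3 tt ; in-k = same 4 tt
            ; in-one = e-one ; in-size = e-x ; in-end = e-acc }
      in ends-ops⨾ settings safe e

-- `Computes` asks for a single bound on time and words: an initial `8 * Z` plus one for each of the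
-- at most `κ * Z` steps serves for both.
ends-computes : ∀ {p r cmd σ} κ Z {Q} → Ends (8 * Z) cmd σ (κ * Z) Q → WordsBounded (8 * Z) (0 at σ) →
  ∃[ D ] Computes {p} {r} (compile 0 cmd) (0 at σ) D ((8 + κ) * Z)
       × ∃[ τ ] Q τ × (∀ i j → entry D i j ≡ proj₂ τ (proj₁ τ 0 + (toℕ i * r + toℕ j)))
ends-computes {p} {r} {cmd} {σ} κ Z (ends {steps} {τ} e le post) ws =
  D , computes , τ , post , entry-D
  where
  P : Program
  P = compile 0 cmd
  runs : Runs P (8 * Z) (0 at σ) steps (size cmd at τ)
  runs = compile-correct 0 e (placed (sym (++-identityʳ P)))
  D : Matrix ℕ p r
  D = tabulate λ i → tabulate λ j → proj₂ τ (proj₁ τ 0 + (toℕ i * r + toℕ j))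
  entry-D : ∀ i j → entry D i j ≡ proj₂ τ (proj₁ τ 0 + (toℕ i * r + toℕ j))
  entry-D i j = trans (cong (λ row → lookup row j) (lookup∘tabulate _ i)) (lookup∘tabulate _ j)
  computes : Computes P (0 at σ) D ((8 + κ) * Z)
  computes .Computes.time = steps
  computes .Computes.time-bound = ≤-trans le (*-monoˡ-≤ Z (m≤n+m κ 8))
  computes .Computes.word-bound m m≤ = widen (run P m (0 at σ))
    (≤-trans (+-monoʳ-≤ (8 * Z) (≤-trans m≤ le)) (≤-reflexive (sym (*-distribʳ-+ Z 8 κ))))
    (runs .Runs.grows (8 * Z) ≤-refl ws m m≤)
  computes .Computes.halts rewrite runs .Runs.final =
    cong List.head (drop-all (size cmd) P (≤-reflexive (length-compile 0 cmd)))
  computes .Computes.output i j rewrite runs .Runs.final = sym (entry-D i j)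

input-bounded : ∀ {p q r ℓ k w} (A : Matrix01 p q) (B : Matrix01 q r) →
  p ≤ w → q ≤ w → r ≤ w → ℓ ≤ w → k ≤ w → 1 ≤ w → WordsBounded w (input A B ℓ k)
input-bounded {p} {q} {r} {ℓ} {k} {w} A B p≤ q≤ r≤ ℓ≤ k≤ 1≤w = regs , λ x → ≤-trans (Input.M₀-bit A B x) 1≤w
  where
  regs : ∀ x → cells (p ∷ q ∷ r ∷ ℓ ∷ k ∷ []) x ≤ w
  regs 0 = p≤
  regs 1 = q≤
  regs 2 = r≤
  regs 3 = ℓ≤
  regs 4 = k≤
  regs (suc (suc (suc (suc (suc _))))) = z≤n

-- For `q = 0` the product and the whole memory are zero, so the address `x` may be arbitrary;
-- register 0 still holds `p` in that case.
empty-product : ∀ {p q r} (A : Matrix01 p q) (B : Matrix01 q r) → q ≡ 0 → ∀ i j x e →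
                ∣ entry (A ⊗ B) i j - Input.M₀ A B x ∣ ≤ e
empty-product {p} {r = r} A B refl i j x e
  rewrite Input.entry-⊗ A B i j
        | Input.M₀-empty A B {x} (subst₂ (λ m n → m + n ≤ x) (sym (*-zeroʳ p)) (sym (*-zeroʳ r)) z≤n) = z≤n

-- The two cases: clustering rows of A, clustering columns of B

module RowCase {p q r ℓ k : ℕ} (A : Matrix01 p q) (B : Matrix01 q r)
  (1≤ℓ : 1 ≤ ℓ) (ℓ≤p : ℓ ≤ p) (1≤k : 1 ≤ k) (k≤r : k ≤ r) (r≤p : r ≤ p) where

  1≤r : 1 ≤ r
  1≤r = ≤-trans 1≤k k≤r

  open Input A B
  open Sizes {q = q} r≤p 1≤ℓ ℓ≤p 1≤r
  module F = Farthest p q r ℓ 0 q 1 (p * q) r 1 r 1 N M₀ (8 * Z)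

  r1≤Z : r * 1 ≤ Z
  r1≤Z = ≤-trans (≤-reflexive (*-identityʳ r)) r≤Z

  q1≤Z : q * 1 ≤ Z
  q1≤Z = ≤-trans (≤-reflexive (*-identityʳ q)) q≤Z

  qr≤Z : q * r ≤ Z
  qr≤Z = ≤-trans (≤-reflexive (*-comm q r)) rq≤Z

  N-bound : AtMost 2 Z N
  N-bound = once pq≤Z ⊕ once rq≤Z

  O-bound : AtMost 5 Z F.O
  O-bound = ((N-bound ⊕ once p≤Z) ⊕ once p≤Z) ⊕ once ℓr≤Z

  layout : F.Layout
  layout = record
    { 1≤p = 1≤p ; 1≤ℓ = 1≤ℓ ; A-low = A-low ; B-low = B-low
    ; A-bit = λ _ _ → M₀-bit _
    ; A-bound = bounded (m≤m+n 2 6) (once pq≤Z ⊕ once q1≤Z)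
    ; B-bound = bounded (m≤m+n 3 5) ((once pq≤Z ⊕ once r1≤Z) ⊕ once qr≤Z)
    ; O-bound = bounded (m≤m+n 7 1) ((O-bound ⊕ once pr≤Z) ⊕ once r1≤Z)
    ; q-bound = bounded (m≤m+n 1 7) (once q≤Z)
    ; empty = M₀-empty
    ; O-inj = λ {i} {i′} {j} {j′} i<p i′<p j<r j′<r eq → rowMajor-inj i<p i′<p j<r j′<r
        (subst₂ (λ x y → i * r + x ≡ i′ * r + y) (*-identityʳ j) (*-identityʳ j′) eq)
    }

  -- Only the two register additions in `finish` call for a bound; they produce `ptrs` and
  -- `products`.
  settings-safe : ∀ {R} → Measured A B ℓ k R → AllSafe (8 * Z) rowSettings (R , M₀)
  settings-safe me = _ , _ , _ , _ , _ , _ , _ , _ , _ , _ , _ , _ ,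
    subst (_≤ 8 * Z) (sym e-ptrs) (bounded (m≤m+n 3 5) (N-bound ⊕ once p≤Z)) ,
    subst (_≤ 8 * Z) (sym (cong₂ _+_ e-ptrs (copied in-p)))
      (bounded (m≤m+n 4 4) ((N-bound ⊕ once p≤Z) ⊕ once p≤Z)) , _
    where
    open Measured me
    e-ptrs = cong₂ _+_ (copied in-end) (copied in-p)

  main-run : ∀ {R} → Measured A B ℓ k R →
    Ends (8 * Z) main (acts rowSettings (R , M₀)) (roundsCost p q r ℓ + copyCost p r)
      (λ (R′ , M′) → R′ 0 ≡ F.O × (∀ i → i < p → F.Represented layout M′ i))
  main-run me = F.main-ends layout
    ( in-q ∷ in-one ∷ copied in-p ∷ copied in-r ∷ copied in-ℓ ∷ refl ∷ copied in-q ∷ refl ∷ copied in-size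
    ∷ copied in-r ∷ refl ∷ copied in-r ∷ refl ∷ copied in-end ∷ e-ptrs ∷ [])
    (cong₂ _+_ e-ptrs (copied in-p)) refl (copied (copied in-ℓ))
    where
    open Measured me
    e-ptrs = cong₂ _+_ (copied in-end) (copied in-p)

  dist-ham : ∀ i c → F.dist (toℕ i) (toℕ c) ≡ ham (lookup A i) (lookup A c)
  dist-ham i c = sym (ham-∑ (lookup A i) (lookup A c) {F.A (toℕ i)} {F.A (toℕ c)}
    (λ h → sym (M₀-A i h)) (λ h → sym (M₀-A c h)))

  error : ∀ {o M} → o ≡ F.O → (∀ i → i < p → F.Represented layout M i) → ∀ i j →
          ∣ entry (A ⊗ B) i j - M (o + (toℕ i * r + toℕ j)) ∣ ≤ 2 * λ-row A ℓ
  error {o} {M} e0 reps i j with reps (toℕ i) (Fin.toℕ<n i)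
  ... | F.represented {c} c<p out count rows far = begin
    ∣ entry (A ⊗ B) i j - M (o + (toℕ i * r + toℕ j)) ∣
      ≡⟨ cong₂ ∣_-_∣ (entry-⊗ i j) (trans (cong M address) (out (toℕ j) (Fin.toℕ<n j))) ⟩
    ∣ ∑ q (λ h → F.A (toℕ i) h * F.B (toℕ j) h) - F.dot c (toℕ j) ∣
      ≤⟨ dot-error q (λ _ _ → M₀-bit _) (λ _ _ → M₀-bit _) ⟩
    F.dist (toℕ i) c
      ≤⟨ separation≤2λ-indexed A {F.dist} dist-ham (cong suc count)
           (F.dist-≤ layout (Fin.toℕ<n i) c<p) rows far ⟩
    2 * λ-row A ℓ ∎
    where
    open ≤-Reasoning
    address : o + (toℕ i * r + toℕ j) ≡ F.O + toℕ i * r + toℕ j * 1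
    address = trans (cong₂ _+_ e0 (cong (toℕ i * r +_) (sym (*-identityʳ (toℕ j))))) (sym (+-assoc F.O _ _))

  run-ends : Ends (8 * Z) (program rowSettings) (inputStore A B ℓ k) (121 * Z)
               (λ (R , M) → ∀ i j → ∣ entry (A ⊗ B) i j - M (R 0 + (toℕ i * r + toℕ j)) ∣ ≤ 2 * λ-row A ℓ)
  run-ends = program-ends rowSettings A B (bounded (m≤m+n 2 6) N-bound)
    (≤-trans 1≤Z (m≤m+n Z (120 * Z))) (λ 1≤q → AtMost.bound (program-≤ 1≤q p≤Z r≤Z))
    (λ q≡0 i j → empty-product A B q≡0 i j _ _)
    λ R me → settings-safe me , ends-weaken ≤-refl (λ _ _ (e0 , reps) → error e0 reps) (main-run me)

  computes : ∃[ D ] Computes {p} {r} (compile 0 (program rowSettings)) (input A B ℓ k) D (129 * Z)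
                  × ((i : Fin p) (j : Fin r) → ∣ entry (A ⊗ B) i j - entry D i j ∣ ≤ 2 * λ-row A ℓ)
  computes =
    let D , comp , τ , err , entry-D = ends-computes 121 Z run-ends
          (input-bounded A B (at p≤Z) (at q≤Z) (at r≤Z) (at (≤-trans ℓ≤p p≤Z)) (at (≤-trans k≤r r≤Z)) (at 1≤Z))
    in D , comp , λ i j → subst (λ z → ∣ entry (A ⊗ B) i j - z ∣ ≤ 2 * λ-row A ℓ) (sym (entry-D i j)) (err i j)
    where
    at : ∀ {x} → x ≤ Z → x ≤ 8 * Z
    at le = bounded (m≤m+n 1 7) (once le)

module ColCase {p q r ℓ k : ℕ} (A : Matrix01 p q) (B : Matrix01 q r)
  (1≤ℓ : 1 ≤ ℓ) (ℓ≤p : ℓ ≤ p) (1≤k : 1 ≤ k) (k≤r : k ≤ r) (p≤r : p ≤ r) where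

  1≤p′ : 1 ≤ p
  1≤p′ = ≤-trans 1≤ℓ ℓ≤p

  open Input A B
  -- Here `p` and `r` are exchanged and `k` replaces `ℓ`, so that `p≤Z` is a fact about `r` and
  -- `r≤Z` one about `p`.
  open Sizes {q = q} p≤r 1≤k k≤r 1≤p′
  module F = Farthest r q p k (p * q) 1 r 0 1 q 1 r N M₀ (8 * Z)

  r1≤Z : r * 1 ≤ Z
  r1≤Z = ≤-trans (≤-reflexive (*-identityʳ r)) p≤Z

  q1≤Z : q * 1 ≤ Z
  q1≤Z = ≤-trans (≤-reflexive (*-identityʳ q)) q≤Z

  qr≤Z : q * r ≤ Z
  qr≤Z = ≤-trans (≤-reflexive (*-comm q r)) pq≤Z

  N-bound : AtMost 2 Z N
  N-bound = once rq≤Z ⊕ once pq≤Z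

  O-bound : AtMost 5 Z F.O
  O-bound = ((N-bound ⊕ once p≤Z) ⊕ once p≤Z) ⊕ once ℓr≤Z

  layout : F.Layout
  layout = record
    { 1≤p = 1≤p ; 1≤ℓ = 1≤k ; A-low = B-low ; B-low = A-low
    ; A-bit = λ _ _ → M₀-bit _
    ; A-bound = bounded (m≤m+n 3 5) ((once rq≤Z ⊕ once r1≤Z) ⊕ once qr≤Z)
    ; B-bound = bounded (m≤m+n 2 6) (once rq≤Z ⊕ once q1≤Z)
    ; O-bound = bounded (m≤m+n 7 1)
        ((O-bound ⊕ once r1≤Z) ⊕ once (≤-trans (≤-reflexive (*-comm p r)) pr≤Z))
    ; q-bound = bounded (m≤m+n 1 7) (once q≤Z)
    ; empty = M₀-empty
    ; O-inj = λ {j} {j′} {i} {i′} j<r j′<r i<p i′<p eq → swap (rowMajor-inj i<p i′<p j<r j′<r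
        (trans (address i j) (trans eq (sym (address i′ j′)))))
    }
    where
    address : ∀ i j → i * r + j ≡ j * 1 + i * r
    address i j = trans (+-comm (i * r) j) (cong (_+ i * r) (sym (*-identityʳ j)))

  settings-safe : ∀ {R} → Measured A B ℓ k R → AllSafe (8 * Z) colSettings (R , M₀)
  settings-safe me = _ , _ , _ , _ , _ , _ , _ , _ , _ , _ , _ , _ ,
    subst (_≤ 8 * Z) (sym e-ptrs) (bounded (m≤m+n 3 5) (N-bound ⊕ once p≤Z)) ,
    subst (_≤ 8 * Z) (sym (cong₂ _+_ e-ptrs (copied in-r)))
      (bounded (m≤m+n 4 4) ((N-bound ⊕ once p≤Z) ⊕ once p≤Z)) , _
    where
    open Measured me
    e-ptrs = cong₂ _+_ (copied in-end) (copied in-r)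

  main-run : ∀ {R} → Measured A B ℓ k R →
    Ends (8 * Z) main (acts colSettings (R , M₀)) (roundsCost r q p k + copyCost r p)
      (λ (R′ , M′) → R′ 0 ≡ F.O × (∀ j → j < r → F.Represented layout M′ j))
  main-run me = F.main-ends layout
    ( in-q ∷ in-one ∷ copied in-r ∷ copied in-p ∷ copied in-k ∷ copied in-size ∷ refl ∷ copied in-r ∷ refl
    ∷ refl ∷ copied in-q ∷ refl ∷ copied in-r ∷ copied in-end ∷ e-ptrs ∷ [])
    (cong₂ _+_ e-ptrs (copied in-r)) (copied (copied in-size)) (copied (copied in-k))
    where
    open Measured me
    e-ptrs = cong₂ _+_ (copied in-end) (copied in-r)

  dist-ham : ∀ j c → F.dist (toℕ j) (toℕ c) ≡ ham (lookup (transpose B) j) (lookup (transpose B) c)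
  dist-ham j c = sym (ham-∑ (lookup (transpose B) j) (lookup (transpose B) c) {F.A (toℕ j)} {F.A (toℕ c)}
    (entry-transpose-B j) (entry-transpose-B c))

  error : ∀ {o M} → o ≡ F.O → (∀ j → j < r → F.Represented layout M j) → ∀ i j →
          ∣ entry (A ⊗ B) i j - M (o + (toℕ i * r + toℕ j)) ∣ ≤ 2 * λ-col B k
  error {o} {M} e0 reps i j with reps (toℕ j) (Fin.toℕ<n j)
  ... | F.represented {c} c<r out count columns far = begin
    ∣ entry (A ⊗ B) i j - M (o + (toℕ i * r + toℕ j)) ∣
      ≡⟨ cong₂ ∣_-_∣
           -- The clustered factor is the right one now, so each product is commuted before rows are
           -- compared.
           (trans (entry-⊗ i j) (∑-cong q λ h _ → *-comm (F.B (toℕ i) h) (F.A (toℕ j) h)))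
           (trans (cong M address) (out (toℕ i) (Fin.toℕ<n i))) ⟩
    ∣ ∑ q (λ h → F.A (toℕ j) h * F.B (toℕ i) h) - F.dot c (toℕ i) ∣
      ≤⟨ dot-error q (λ _ _ → M₀-bit _) (λ _ _ → M₀-bit _) ⟩
    F.dist (toℕ j) c
      ≤⟨ separation≤2λ-indexed (transpose B) {F.dist} dist-ham (cong suc count)
           (F.dist-≤ layout (Fin.toℕ<n j) c<r) columns far ⟩
    2 * λ-col B k ∎
    where
    open ≤-Reasoning
    address : o + (toℕ i * r + toℕ j) ≡ F.O + toℕ j * 1 + toℕ i * r
    address = trans
      (cong₂ _+_ e0 (trans (+-comm (toℕ i * r) (toℕ j)) (cong (_+ toℕ i * r) (sym (*-identityʳ (toℕ j))))))
      (sym (+-assoc F.O _ _))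

  run-ends : Ends (8 * Z) (program colSettings) (inputStore A B ℓ k) (121 * Z)
               (λ (R , M) → ∀ i j → ∣ entry (A ⊗ B) i j - M (R 0 + (toℕ i * r + toℕ j)) ∣ ≤ 2 * λ-col B k)
  run-ends = program-ends colSettings A B (bounded (m≤m+n 2 6) N-bound)
    (≤-trans 1≤Z (m≤m+n Z (120 * Z))) (λ 1≤q → AtMost.bound (program-≤ 1≤q r≤Z p≤Z))
    (λ q≡0 i j → empty-product A B q≡0 i j _ _)
    λ R me → settings-safe me , ends-weaken ≤-refl (λ _ _ (e0 , reps) → error e0 reps) (main-run me)

  computes : ∃[ D ] Computes {p} {r} (compile 0 (program colSettings)) (input A B ℓ k) D
                      (129 * (r * q * k + p * r))
                  × ((i : Fin p) (j : Fin r) → ∣ entry (A ⊗ B) i j - entry D i j ∣ ≤ 2 * λ-col B k)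
  computes =
    let D , comp , τ , err , entry-D = ends-computes 121 Z run-ends
          (input-bounded A B (at r≤Z) (at q≤Z) (at p≤Z)
            (at (≤-trans ℓ≤p r≤Z)) (at (≤-trans k≤r p≤Z)) (at 1≤Z))
    -- `Z` ends in `r * p` here, the claimed time bound in `p * r`.
    in D , subst (λ z → Computes (compile 0 (program colSettings)) (input A B ℓ k) D (129 * (r * q * k + z)))
             (*-comm r p) comp
         , λ i j → subst (λ z → ∣ entry (A ⊗ B) i j - z ∣ ≤ 2 * λ-col B k) (sym (entry-D i j)) (err i j)
    where
    at : ∀ {x} → x ≤ Z → x ≤ 8 * Z
    at le = bounded (m≤m+n 1 7) (once le)

theorem1 :
    (∃[ P ] ∃[ c ] ∀ {p q r ℓ k : ℕ} (A : Matrix01 p q) (B : Matrix01 q r) →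
       1 ≤ ℓ → ℓ ≤ p → 1 ≤ k → k ≤ r → p ≥ r →
       ∃[ D ] Computes {p} {r} P (input A B ℓ k) D (c * (p * q * ℓ + p * r))
            × ((i : Fin p) (j : Fin r) → ∣ entry (A ⊗ B) i j - entry D i j ∣ ≤ 2 * λ-row A ℓ))
    ×
    (∃[ P ] ∃[ c ] ∀ {p q r ℓ k : ℕ} (A : Matrix01 p q) (B : Matrix01 q r) →
       1 ≤ ℓ → ℓ ≤ p → 1 ≤ k → k ≤ r → p ≤ r →
       ∃[ D ] Computes {p} {r} P (input A B ℓ k) D (c * (r * q * k + p * r))
            × ((i : Fin p) (j : Fin r) → ∣ entry (A ⊗ B) i j - entry D i j ∣ ≤ 2 * λ-col B k))
theorem1 = (compile 0 (program rowSettings) , 129 , λ A B → RowCase.computes A B)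
         , (compile 0 (program colSettings) , 129 , λ A B → ColCase.computes A B)
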